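{- Let $c_0$ be a proper $4$-colouring of the plane, let $\mu$ be a left-invariant finitely additive probability measure on $S_4\times E(2)$, and let $p_d$ be the associated monochromaticity probabilities (see context). Then for real $d$: (1) if $\frac12\le d\le\sqrt{(3-\sqrt3)\left(1-\frac1{\sqrt2}\right)}$, then $p_d\ge\frac1{125}$; (2) if $\sqrt{(3-\sqrt3)\left(1-\frac1{\sqrt2}\right)}<d\le\sqrt{\frac{19}{15}-\frac2{\sqrt5}}$, then $p_d\ge\frac{28}{3875}$; (3) if $\sqrt{\frac{19}{15}-\frac2{\sqrt5}}<d\le\frac12\sqrt{5-2\sqrt3}$, then $p_d\ge\frac1{250}$; (4) if $\frac12\sqrt{5+2\sqrt3}\le d<\sqrt{\frac{19}{15}+\frac2{\sqrt5}}$, then $p_d\ge\frac1{250}$; (5) if $\sqrt{\frac{19}{15}+\frac2{\sqrt5}}\le d<\sqrt{(3-\sqrt3)\left(1+\frac1{\sqrt2}\right)}$, then $p_d\ge\frac{28}{3875}$; (6) if $\sqrt{(3-\sqrt3)\left(1+\frac1{\sqrt2}\right)}\le d$, then $p_d\ge\frac1{125}$.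
   Context: Identify the plane with $\mathbb C$. A proper $4$-colouring of the plane is a map $c_0:\mathbb C\to\{1,2,3,4\}$ such that no two points at distance $1$ have the same colour. Let $S_4$ be the group of permutations of the colours and $E(2)$ the group of Euclidean isometries of the plane. The group $S_4\times E(2)$ is amenable, so there is a finitely additive probability measure $\mu$ defined on all subsets of $S_4\times E(2)$ which is left-invariant, i.e. $\mu(gE)=\mu(E)$ for all $g\in S_4\times E(2)$ and $E\subseteq S_4\times E(2)$. For $(\sigma,T)\in S_4\times E(2)$ consider the (random) colouring $c=\sigma\circ c_0\circ T^{ -1}$. For $d\ge 0$, $p_d$ denotes the probability that two points $A,B$ at distance $d$ get the same colour: $p_d=\mu(\{(\sigma,T): c(A)=c(B)\})$; by left-invariance this does not depend on the choice of $A,B$ with $|AB|=d$. The existence of $c_0$ is a standing assumption, and $c_0,\mu$ are arbitrary but fixed. -}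

module Defs where

open import Algebra.Bundles using (CommutativeRing; Group)
import Algebra.Construct.DirectProduct as DirectProduct
import Algebra.Properties.Ring as RingProperties
import Algebra.Solver.Ring.NaturalCoefficients.Default as SemiringSolver
open import Algebra.Definitions.RawMonoid using (_×_)
open import Data.Fin.Base using (Fin)
open import Data.Fin.Permutation as Perm using (Permutation′; _⟨$⟩ʳ_; _⟨$⟩ˡ_)
open import Data.Nat.Base using (ℕ)
open import Data.Product.Base as Prod using (∃; _,_; proj₁; proj₂)
open import Data.Product.Relation.Binary.Pointwise.NonDependent using (×-setoid)
open import Data.Sum.Base as Sum using (inj₁; inj₂)
open import Data.Unit.Base using (tt)
open import Function.Bundles using (Inverse)
import Function.Construct.Composition as Composition
import Function.Construct.Identity as Identity
import Function.Construct.Symmetry as Symmetry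
open import Level using (0ℓ)
open import Relation.Binary.Bundles using (Setoid)
open import Relation.Binary.Core using (Rel)
open import Relation.Binary.Definitions using (_Respects_)
open import Relation.Binary.PropositionalEquality as ≡ using (_≡_; _≢_)
import Relation.Binary.Construct.NonStrictToStrict as NonStrictToStrict
open import Relation.Binary.Structures using (IsDecTotalOrder)
open import Relation.Nullary.Decidable using (yes; no)
open import Relation.Nullary.Negation using (¬_; contradiction)
open import Relation.Unary using (Pred; Satisfiable; _∈_; _≐_; _∪_; _⊥_; U)

-- The standard library has no real numbers.  They are characterised up to
-- isomorphism as a Dedekind-complete ordered field; the theorem is stated
-- for every such field.  Equality is a setoid equality, so maps out of the
-- reals come with a congruence condition.  The decidability in
-- IsDecTotalOrder is classical trichotomy.
record CompleteOrderedField : Set₁ where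
  infix  4 _≤_
  infix  9 _⁻¹
  field
    commutativeRing : CommutativeRing 0ℓ 0ℓ

  open CommutativeRing commutativeRing public renaming (Carrier to ℝ)

  field
    _≤_             : Rel ℝ 0ℓ
    isDecTotalOrder : IsDecTotalOrder _≈_ _≤_
    +-monoˡ-≤       : ∀ {x y} z → x ≤ y → x + z ≤ y + z
    *-nonNeg        : ∀ {x y} → 0# ≤ x → 0# ≤ y → 0# ≤ x * y
    0≉1             : ¬ (0# ≈ 1#)
    -- The value of 0# ⁻¹ is left unspecified.
    _⁻¹             : ℝ → ℝ
    ⁻¹-inverseʳ     : ∀ x → ¬ (x ≈ 0#) → x * x ⁻¹ ≈ 1#

  UpperBound : Pred ℝ 0ℓ → ℝ → Set
  UpperBound P b = ∀ {x} → x ∈ P → x ≤ b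

  field
    supremum : (P : Pred ℝ 0ℓ) → Satisfiable P → ∃ (UpperBound P) →
               ∃ λ s → UpperBound P s Prod.× (∀ b → UpperBound P b → s ≤ b)

  module Order = IsDecTotalOrder isDecTotalOrder

  open NonStrictToStrict _≈_ _≤_ public using (_<_)

  infixl 7 _/_
  _/_ : ℝ → ℝ → ℝ
  x / y = x * y ⁻¹

  fromℕ : ℕ → ℝ
  fromℕ n = _×_ +-rawMonoid n 1#

module SquareRoot (F : CompleteOrderedField) where
  open CompleteOrderedField F
  open Order using (total; antisym; _≤?_; _≟_; ≲-respˡ-≈; ≲-respʳ-≈)
    renaming (trans to ≤-trans; reflexive to ≤-reflexive; refl to ≤-refl)
  open SemiringSolver commutativeSemiring using (solve; _:=_; _:+_; _:*_)
  open RingProperties ring using (x[y-z]≈xy-xz; -‿distribˡ-*; -‿distribʳ-*; -‿involutive)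

  ≤-resp : ∀ {a b c d} → a ≈ b → c ≈ d → a ≤ c → b ≤ d
  ≤-resp p q r = ≲-respˡ-≈ p (≲-respʳ-≈ q r)

  +-monoʳ-≤ : ∀ z {x y} → x ≤ y → z + x ≤ z + y
  +-monoʳ-≤ z {x} {y} p = ≤-resp (+-comm x z) (+-comm y z) (+-monoˡ-≤ z p)

  +-mono-≤ : ∀ {x y u v} → x ≤ y → u ≤ v → x + u ≤ y + v
  +-mono-≤ {y = y} {u = u} p q = ≤-trans (+-monoˡ-≤ u p) (+-monoʳ-≤ y q)

  x-y+y : ∀ x y → (x - y) + y ≈ x
  x-y+y x y = trans (+-assoc x (- y) y)
              (trans (+-congˡ (-‿inverseˡ y)) (+-identityʳ x))

  x≤y⇒0≤y-x : ∀ {x y} → x ≤ y → 0# ≤ y - x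
  x≤y⇒0≤y-x {x} p = ≲-respˡ-≈ (-‿inverseʳ x) (+-monoˡ-≤ (- x) p)

  0≤y-x⇒x≤y : ∀ {x y} → 0# ≤ y - x → x ≤ y
  0≤y-x⇒x≤y {x} {y} p =
    ≤-resp (+-identityˡ x) (x-y+y y x) (+-monoˡ-≤ x p)

  +-cancelˡ-≤ : ∀ z {x y} → z + x ≤ z + y → x ≤ y
  +-cancelˡ-≤ z {x} {y} p = ≤-resp (cancel x) (cancel y) (+-monoʳ-≤ (- z) p)
    where
    cancel : ∀ w → - z + (z + w) ≈ w
    cancel w = trans (sym (+-assoc _ _ _))
               (trans (+-congʳ (-‿inverseˡ z)) (+-identityˡ w))

  *-monoˡ-≤ : ∀ {x y} z → 0# ≤ z → x ≤ y → z * x ≤ z * y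
  *-monoˡ-≤ {x} {y} z 0≤z p = 0≤y-x⇒x≤y
    (≲-respʳ-≈ (x[y-z]≈xy-xz z y x) (*-nonNeg 0≤z (x≤y⇒0≤y-x p)))

  0≤x² : ∀ x → 0# ≤ x * x
  0≤x² x with total 0# x
  ... | inj₁ p = *-nonNeg p p
  ... | inj₂ p = ≲-respʳ-≈ -x*-x≈x*x
                   (*-nonNeg q q)
    where q : 0# ≤ - x
          q = ≲-respʳ-≈ (+-identityˡ (- x)) (x≤y⇒0≤y-x p)
          -x*-x≈x*x : - x * - x ≈ x * x
          -x*-x≈x*x = trans (sym (-‿distribˡ-* x (- x)))
            (trans (-‿cong (sym (-‿distribʳ-* x x))) (-‿involutive (x * x)))

  0≤1 : 0# ≤ 1#
  0≤1 = ≲-respʳ-≈ (*-identityˡ 1#) (0≤x² 1#)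

  *-cancelˡ-≤ : ∀ {x y} z → 0# ≤ z → ¬ (z ≈ 0#) → z * x ≤ z * y → x ≤ y
  *-cancelˡ-≤ {x} {y} z 0≤z z≉0 p with total x y
  ... | inj₁ x≤y = x≤y
  ... | inj₂ y≤x = ≤-reflexive (trans (sym (undo x)) (trans (*-congˡ zx≈zy) (undo y)))
    where
    zx≈zy : z * x ≈ z * y
    zx≈zy = antisym p (*-monoˡ-≤ z 0≤z y≤x)
    undo : ∀ w → z ⁻¹ * (z * w) ≈ w
    undo w = trans (sym (*-assoc _ _ _))
             (trans (*-congʳ (trans (*-comm _ _) (⁻¹-inverseʳ z z≉0))) (*-identityˡ w))

  *-/ : ∀ z x → ¬ (z ≈ 0#) → z * (x / z) ≈ x
  *-/ z x z≉0 = trans (*-congˡ (*-comm x (z ⁻¹)))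
                (trans (sym (*-assoc _ _ _))
                (trans (*-congʳ (⁻¹-inverseʳ z z≉0)) (*-identityˡ x)))

  abstract
    sqrt : ∀ a → 0# ≤ a → ∃ λ y → 0# ≤ y Prod.× y * y ≈ a
    sqrt a 0≤a = s , 0≤s , antisym s²≤a a≤s²
      where
      P : Pred ℝ 0ℓ
      P x = x * x ≤ a

      0∈P : 0# ∈ P
      0∈P = ≲-respˡ-≈ (sym (zeroˡ 0#)) 0≤a

      a≤1+a : a ≤ 1# + a
      a≤1+a = ≲-respˡ-≈ (+-identityˡ a) (+-monoˡ-≤ a 0≤1)

      1≤1+a : 1# ≤ 1# + a
      1≤1+a = ≲-respˡ-≈ (+-identityʳ 1#) (+-monoʳ-≤ 1# 0≤a)

      bounded : UpperBound P (1# + a)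
      bounded {x} x²≤a with total x (1# + a)
      ... | inj₁ p = p
      ... | inj₂ p = ≤-trans (≤-trans x≤x² x²≤a) a≤1+a
        where
        1≤x : 1# ≤ x
        1≤x = ≤-trans 1≤1+a p
        x≤x² : x ≤ x * x
        x≤x² = ≲-respˡ-≈ (*-identityʳ x) (*-monoˡ-≤ x (≤-trans 0≤1 1≤x) 1≤x)

      sup : ∃ λ s → UpperBound P s Prod.× (∀ b → UpperBound P b → s ≤ b)
      sup = supremum P (0# , 0∈P) (1# + a , bounded)

      s : ℝ
      s = proj₁ sup

      upper : UpperBound P s
      upper = proj₁ (proj₂ sup)

      0≤s : 0# ≤ s
      0≤s = upper 0∈P

      0≤s+s : 0# ≤ s + s
      0≤s+s = ≲-respˡ-≈ (+-identityˡ 0#) (+-mono-≤ 0≤s 0≤s)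

      s²≤a : s * s ≤ a
      s²≤a with s + s ≟ 0#
      ... | yes 2s≈0 = ≲-respˡ-≈ (sym (trans (*-congˡ s≈0) (zeroʳ s))) 0≤a
        where
        s≈0 : s ≈ 0#
        s≈0 = antisym
          (≤-resp (+-identityʳ s) 2s≈0 (+-monoʳ-≤ s 0≤s)) 0≤s
      ... | no 2s≉0 = +-cancelˡ-≤ (s * s) (≲-respˡ-≈ (distribʳ s s s) 2ss≤s²+a)
        where
        t : ℝ
        t = (s * s + a) / (s + s)
        2sx≤s²+x² : ∀ x → (s + s) * x ≤ s * s + x * x
        2sx≤s²+x² x = ≤-resp
          (trans (+-identityʳ _) (*-congˡ s+k≈x))
          (trans (solve 2 (λ s k → (((s :+ s) :* (s :+ k)) :+ (k :* k)) :=
                                   ((s :* s) :+ ((s :+ k) :* (s :+ k)))) refl s k)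
                 (+-congˡ (*-cong s+k≈x s+k≈x)))
          (+-monoʳ-≤ ((s + s) * (s + k)) (0≤x² k))
          where
          k : ℝ
          k = x - s
          s+k≈x : s + k ≈ x
          s+k≈x = trans (+-comm s k) (x-y+y x s)
        2ss≤s²+a : (s + s) * s ≤ s * s + a
        2ss≤s²+a = ≲-respʳ-≈ (*-/ (s + s) _ 2s≉0)
          (*-monoˡ-≤ (s + s) 0≤s+s (proj₂ (proj₂ sup) t λ {x} x∈P →
            *-cancelˡ-≤ (s + s) 0≤s+s 2s≉0
              (≲-respʳ-≈ (sym (*-/ (s + s) _ 2s≉0))
                (≤-trans (2sx≤s²+x² x) (+-monoʳ-≤ (s * s) x∈P)))))

      a≤s² : a ≤ s * s
      a≤s² with total a (s * s)
      ... | inj₁ p = p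
      ... | inj₂ p = ≤-resp (x-y+y a (s * s)) (+-identityˡ (s * s)) (+-monoˡ-≤ (s * s) r≤0)
        where
        D r e : ℝ
        D = (s + s + 1#) + a
        r = a - s * s
        e = r / D
        0≤r : 0# ≤ r
        0≤r = x≤y⇒0≤y-x p
        1≤2s+1 : 1# ≤ s + s + 1#
        1≤2s+1 = ≲-respˡ-≈ (+-identityˡ 1#) (+-monoˡ-≤ 1# 0≤s+s)
        0≤2s+1 : 0# ≤ s + s + 1#
        0≤2s+1 = ≤-trans 0≤1 1≤2s+1
        2s+1≤D : s + s + 1# ≤ D
        2s+1≤D = ≲-respˡ-≈ (+-identityʳ _) (+-monoʳ-≤ _ 0≤a)
        0≤D : 0# ≤ D
        0≤D = ≤-trans 0≤2s+1 2s+1≤D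
        D≉0 : ¬ (D ≈ 0#)
        D≉0 D≈0 = 0≉1 (antisym 0≤1 (≲-respʳ-≈ D≈0 (≤-trans 1≤2s+1 2s+1≤D)))
        De≈r : D * e ≈ r
        De≈r = *-/ D r D≉0
        0≤e : 0# ≤ e
        0≤e = *-cancelˡ-≤ D 0≤D D≉0 (≤-resp (sym (zeroʳ D)) (sym De≈r) 0≤r)
        r≤a : r ≤ a
        r≤a = ≤-resp (+-identityʳ r) (x-y+y a (s * s)) (+-monoʳ-≤ r (0≤x² s))
        a≤D : a ≤ D
        a≤D = ≲-respˡ-≈ (+-identityˡ a) (+-monoˡ-≤ a 0≤2s+1)
        e≤1 : e ≤ 1#
        e≤1 = *-cancelˡ-≤ D 0≤D D≉0
                (≤-resp (sym De≈r) (sym (*-identityʳ D)) (≤-trans r≤a a≤D))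
        step : (s + s + 1#) * e ≤ r
        step = ≤-resp (*-comm e _) (trans (*-comm e D) De≈r) (*-monoˡ-≤ e 0≤e 2s+1≤D)
        s+e∈P : s + e ∈ P
        s+e∈P = ≤-resp
          (solve 2 (λ s e → ((s :* s) :+ (((s :+ s) :* e) :+ (e :* e))) := ((s :+ e) :* (s :+ e))) refl s e)
          (trans (+-comm (s * s) r) (x-y+y a (s * s)))
          (+-monoʳ-≤ (s * s)
            (≤-trans (+-monoʳ-≤ ((s + s) * e) (*-monoˡ-≤ e 0≤e e≤1))
              (≲-respˡ-≈ (trans (distribʳ e (s + s) 1#)
                            (+-congˡ (*-comm 1# e))) step)))
        e≤0 : e ≤ 0#
        e≤0 = ≤-resp (trans (+-congʳ (+-comm s e)) (trans (+-assoc e s (- s))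
                       (trans (+-congˡ (-‿inverseʳ s)) (+-identityʳ e))))
                     (-‿inverseʳ s) (+-monoˡ-≤ (- s) (upper s+e∈P))
        r≤0 : r ≤ 0#
        r≤0 = ≤-resp De≈r (zeroʳ D) (*-monoˡ-≤ D 0≤D e≤0)

  -- The non-negative square root; 0# on negative arguments.
  √ : ℝ → ℝ
  √ a with 0# ≤? a
  ... | yes 0≤a = proj₁ (sqrt a 0≤a)
  ... | no  _   = 0#

  √-cong : ∀ {a b} → a ≈ b → √ a ≈ √ b
  √-cong {a} {b} a≈b with 0# ≤? a | 0# ≤? b
  ... | yes 0≤a | yes 0≤b = unique (sqrt a 0≤a) (sqrt b 0≤b)
    where
    ordered : ∀ {y z} → 0# ≤ y → y ≤ z → y * y ≈ z * z → y ≈ z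
    ordered {y} {z} 0≤y y≤z y²≈z² with z ≟ 0#
    ... | yes z≈0 = antisym y≤z (≲-respˡ-≈ (sym z≈0) 0≤y)
    ... | no  z≉0 = antisym y≤z (*-cancelˡ-≤ z (≤-trans 0≤y y≤z) z≉0
      (≤-resp y²≈z² (*-comm y z) (*-monoˡ-≤ y 0≤y y≤z)))
    unique : (p : ∃ λ y → 0# ≤ y Prod.× y * y ≈ a) (q : ∃ λ z → 0# ≤ z Prod.× z * z ≈ b) →
             proj₁ p ≈ proj₁ q
    unique (y , 0≤y , y²≈a) (z , 0≤z , z²≈b) with total y z
    ... | inj₁ y≤z = ordered 0≤y y≤z (trans y²≈a (trans a≈b (sym z²≈b)))
    ... | inj₂ z≤y = sym (ordered 0≤z z≤y (trans z²≈b (trans (sym a≈b) (sym y²≈a))))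
  ... | yes 0≤a | no 0≰b = contradiction (≲-respʳ-≈ a≈b 0≤a) 0≰b
  ... | no 0≰a | yes 0≤b = contradiction (≲-respʳ-≈ (sym a≈b) 0≤b) 0≰a
  ... | no _   | no _    = refl

module Measure (F : CompleteOrderedField) (G : Group 0ℓ 0ℓ) where
  open CompleteOrderedField F using (ℝ; 0#; 1#) renaming (_≈_ to _≈ℝ_; _≤_ to _≤ℝ_; _+_ to _+ℝ_)
  open Group G

  -- A subset of the quotient of Carrier by _≈_.
  record Subset : Set₁ where
    constructor mkSubset
    field
      pred     : Pred Carrier 0ℓ
      respects : pred Respects _≈_
  open Subset public

  whole : Subset
  whole = mkSubset U (λ _ _ → tt)

  _∪ˢ_ : Subset → Subset → Subset
  A ∪ˢ B = mkSubset (pred A ∪ pred B) λ x≈y → Sum.map (respects A x≈y) (respects B x≈y)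

  infixr 7 _·_
  _·_ : Carrier → Subset → Subset
  g · A = mkSubset (λ y → ∃ λ x → x ∈ pred A Prod.× y ≈ g ∙ x)
    λ y≈z (x , x∈A , y≈gx) → x , x∈A , trans (sym y≈z) y≈gx

  record LeftInvariantProbability : Set₁ where
    field
      μ             : Subset → ℝ
      cong          : ∀ A B → pred A ≐ pred B → μ A ≈ℝ μ B
      nonNeg        : ∀ A → 0# ≤ℝ μ A
      total         : μ whole ≈ℝ 1#
      additive      : ∀ A B → pred A ⊥ pred B → μ (A ∪ˢ B) ≈ℝ μ A +ℝ μ B
      leftInvariant : ∀ g A → μ (g · A) ≈ℝ μ A

S₄ : Group 0ℓ 0ℓ
S₄ = record
  { Carrier = Permutation′ 4
  ; _≈_     = Perm._≈_
  ; _∙_     = λ σ τ → τ Perm.∘ₚ σ   -- _∘ₚ_ applies its left argument first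
  ; ε       = Perm.id
  ; _⁻¹     = Perm.flip
  ; isGroup = record
    { isMonoid = record
      { isSemigroup = record
        { isMagma = record
          { isEquivalence = record
            { refl  = λ _ → ≡.refl
            ; sym   = λ p i → ≡.sym (p i)
            ; trans = λ p q i → ≡.trans (p i) (q i)
            }
          ; ∙-cong = λ {σ} {σ′} {τ} {τ′} p q i →
              ≡.trans (≡.cong (σ ⟨$⟩ʳ_) (q i)) (p (τ′ ⟨$⟩ʳ i))
          }
        ; assoc = λ _ _ _ _ → ≡.refl
        }
      ; identity = (λ _ _ → ≡.refl) , (λ _ _ → ≡.refl)
      }
    ; inverse = (λ σ _ → Perm.inverseˡ σ) , (λ σ _ → Perm.inverseʳ σ)
    ; ⁻¹-cong = λ {σ} {τ} p i →
        ≡.trans (≡.cong (σ ⟨$⟩ˡ_) (≡.sym (≡.trans (p _) (Perm.inverseʳ τ))))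
                (Perm.inverseˡ σ)
    }
  }

module Plane (F : CompleteOrderedField) where
  open CompleteOrderedField F
  open SquareRoot F public using (√; √-cong)

  plane : Setoid 0ℓ 0ℓ
  plane = ×-setoid setoid setoid

  open Setoid plane public using () renaming (Carrier to Point; _≈_ to _≈ₚ_)
  private module P = Setoid plane

  dist : Point → Point → ℝ
  dist (x , y) (x′ , y′) = √ ((x - x′) * (x - x′) + (y - y′) * (y - y′))

  record Isometry : Set where
    field
      bijection : Inverse plane plane
    open Inverse bijection public
    field
      isometric : ∀ A B → dist (to A) (to B) ≈ dist A B
  open Isometry

  dist-cong : ∀ {A A′ B B′} → A ≈ₚ A′ → B ≈ₚ B′ → dist A B ≈ dist A′ B′
  dist-cong (p , q) (p′ , q′) = √-cong (+-cong (*-cong u u) (*-cong v v))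
    where
    u = +-cong p (-‿cong p′)
    v = +-cong q (-‿cong q′)

  from-unique : ∀ {S T : Isometry} → (∀ A → to S A ≈ₚ to T A) →
                ∀ A → from S A ≈ₚ from T A
  from-unique {S} {T} S≈T A = P.trans
    (from-cong S (P.sym (P.trans (S≈T (from T A)) (strictlyInverseˡ T A))))
    (strictlyInverseʳ S (from T A))

  E₂ : Group 0ℓ 0ℓ
  E₂ = record
    { Carrier = Isometry
    ; _≈_     = λ S T → ∀ A → to S A ≈ₚ to T A
    ; _∙_     = λ S T → record
      { bijection = Composition.inverse (bijection T) (bijection S)
      ; isometric = λ A B → trans (isometric S (to T A) (to T B)) (isometric T A B)
      }
    ; ε       = record
      { bijection = Identity.inverse plane
      ; isometric = λ _ _ → refl
      }
    ; _⁻¹     = λ T → record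
      { bijection = Symmetry.inverse (bijection T)
      ; isometric = λ A B → trans (sym (isometric T (from T A) (from T B)))
          (dist-cong (strictlyInverseˡ T A) (strictlyInverseˡ T B))
      }
    ; isGroup = record
      { isMonoid = record
        { isSemigroup = record
          { isMagma = record
            { isEquivalence = record
              { refl  = λ _ → P.refl
              ; sym   = λ p A → P.sym (p A)
              ; trans = λ p q A → P.trans (p A) (q A)
              }
            ; ∙-cong = λ {S} {S′} {T} {T′} p q A →
                P.trans (to-cong S (q A)) (p (to T′ A))
            }
          ; assoc = λ _ _ _ _ → P.refl
          }
        ; identity = (λ _ _ → P.refl) , (λ _ _ → P.refl)
        }
      ; inverse = strictlyInverseʳ , strictlyInverseˡ
      ; ⁻¹-cong = λ {S} {T} → from-unique {S} {T}
      }
    }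

  S₄×E₂ : Group 0ℓ 0ℓ
  S₄×E₂ = DirectProduct.group S₄ E₂

  open Measure F S₄×E₂ public using (Subset; mkSubset; LeftInvariantProbability)
  open LeftInvariantProbability using (μ)

  record ProperColouring : Set where
    field
      colour      : Point → Fin 4
      colour-cong : ∀ {A B} → A ≈ₚ B → colour A ≡ colour B
      proper      : ∀ {A B} → dist A B ≈ 1# → colour A ≢ colour B
  open ProperColouring

  randomColouring : ProperColouring → Group.Carrier S₄×E₂ → Point → Fin 4
  randomColouring c₀ (σ , T) A = σ ⟨$⟩ʳ colour c₀ (from T A)

  Monochromatic : ProperColouring → Point → Point → Subset
  Monochromatic c₀ A B = mkSubset
    (λ g → randomColouring c₀ g A ≡ randomColouring c₀ g B)
    λ {g} {h} g≈h eq → ≡.trans (≡.sym (same g h g≈h A)) (≡.trans eq (same g h g≈h B))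
    where
    same : ∀ g h → Group._≈_ S₄×E₂ g h → ∀ C → randomColouring c₀ g C ≡ randomColouring c₀ h C
    same (σ , S) (τ , T) (σ≈τ , S≈T) C =
      ≡.trans (≡.cong (σ ⟨$⟩ʳ_) (colour-cong c₀ (from-unique {S} {T} S≈T C))) (σ≈τ _)

  -- p_d, computed from a particular pair of points A, B at distance d.
  probMono : ProperColouring → LeftInvariantProbability → Point → Point → ℝ
  probMono c₀ m A B = μ m (Monochromatic c₀ A B)

{-# OPTIONS --safe #-}
module Submission where

-- Upper bound.  Let 1/2 ≤ x, and let u₀, u₁ be at distance x from o and 1 apart.
-- Write ω for the rotation by 60° about o, τ for the probability that o, u₀ and
-- ω u₀ (an equilateral triangle of side x) have one colour, and p_y for the
-- probability that two points at distance y do.  The point T making an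
-- equilateral triangle with ω u₀ and ω u₁ gives 3 p_x ≤ 1 + τ, since at most one
-- vertex of a unit triangle has the colour of o.  Five points of the triangular
-- lattice of side x with four colours give 13 τ + 1 ≤ 11 p_x + 2 p_{√3x} + p_{2x}.
-- Together 28 p_x ≤ 12 + 2 p_{√3x} + p_{2x}, so S, the supremum of p_x over
-- 1/2 ≤ x, satisfies 28 S ≤ 12 + 3 S, that is S ≤ 12/25.
--
-- Lower bound.  Put h = √(d² - 1/4).  In a unit equilateral triangle take P at
-- height h over one side, inwards, and Q at height h over another, outwards.
-- Among the ten distances between the five points, three are 1, five are d, and
-- the others are |√3/2 - h| and √3/2 + h.  Two of the five points have the same
-- colour, so 1 ≤ 5 p_d + 12/25 + 12/25 as soon as the last two distances are at
-- least 1/2, which holds for all d in question.  Hence 1/125 ≤ p_d throughout.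

open import Defs
open import Data.Product using (_×_)

open import Algebra.Bundles using (CommutativeRing; Group)
import Algebra.Properties.AbelianGroup as AbelianGroupProperties
import Algebra.Properties.Ring as RingProperties
import Algebra.Properties.Semiring.Mult as SemiringMult
import Algebra.Solver.Ring as RingSolver
open import Algebra.Solver.Ring.AlmostCommutativeRing
  using (fromCommutativeRing; _-Raw-AlmostCommutative⟶_)
open import Data.Bool.Base using (if_then_else_; _∧_)
open import Data.Fin using (Fin; #_)
import Data.Fin.Permutation as Perm
open Perm using (_⟨$⟩ʳ_)
import Data.Fin.Properties as Fin
open import Data.Integer.Base as ℤ using (ℤ; +_; -[1+_])
import Data.Integer.Properties as ℤ
open import Data.List.Base as List using (List; []; _∷_; [_])
open import Data.List.Relation.Binary.Pointwise.Base using (Pointwise; []; _∷_)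
open import Data.List.Relation.Unary.All as All using (All; []; _∷_)
open import Data.Maybe.Base using (Maybe; just; nothing)
open import Data.Nat.Base as ℕ using (ℕ; zero; suc; z≤n; s≤s)
import Data.Nat.Properties as ℕ
open import Data.Product.Base using (∃; _,_; proj₁; proj₂)
open import Data.Sum.Base using (_⊎_; inj₁; inj₂; [_,_]′)
open import Data.Unit.Base using (tt)
open import Data.Vec.Base as Vec using (Vec; []; _∷_; lookup)
open import Data.Vec.Properties using (lookup-map)
open import Function.Bundles using (Injection)
open import Function.Properties.Inverse using (↔⇒↣)
open import Level using (0ℓ)
open import Relation.Binary.Bundles using (Setoid)
open import Relation.Binary.PropositionalEquality as ≡ using (_≡_)
open import Relation.Nullary.Decidable using (Dec; yes; no; does; map′; from-yes)
open import Relation.Nullary.Negation using (¬_; contradiction)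
open import Relation.Unary using (Pred; _∈_; _∉_)

-- A ring solver with integer coefficients for commutative rings.

module IntegerRingSolver (R : CommutativeRing 0ℓ 0ℓ) where
  open CommutativeRing R
  open RingProperties ring
  open AbelianGroupProperties +-abelianGroup using (⁻¹-∙-comm)
  open SemiringMult semiring renaming (_×_ to _•_)
  open import Relation.Binary.Reasoning.Setoid setoid

  -- ⟦ + 1 ⟧ is 1# rather than 1# + 0#, so that literal occurrences of 1# are
  -- recognised as constants.
  ⟦_⟧ : ℤ → Carrier
  ⟦ + 1 ⟧     = 1#
  ⟦ + n ⟧     = n • 1#
  ⟦ -[1+ n ] ⟧ = - (suc n • 1#)

  ⟦+⟧ : ∀ n → ⟦ + n ⟧ ≈ n • 1#
  ⟦+⟧ 0 = refl
  ⟦+⟧ 1 = sym (+-identityʳ 1#)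
  ⟦+⟧ (suc (suc n)) = refl

  private
    x+y-x+z : ∀ x y z → (x + y) - (x + z) ≈ y - z
    x+y-x+z x y z = begin
      (x + y) - (x + z)       ≈⟨ +-cong (+-comm x y) (sym (⁻¹-∙-comm x z)) ⟩
      (y + x) + (- x + - z)   ≈⟨ +-assoc y x _ ⟩
      y + (x + (- x + - z))   ≈⟨ +-congˡ (sym (+-assoc x (- x) (- z))) ⟩
      y + ((x - x) + - z)     ≈⟨ +-congˡ (trans (+-congʳ (-‿inverseʳ x)) (+-identityˡ _)) ⟩
      y - z                   ∎

    ⟦⊖⟧ : ∀ m n → ⟦ m ℤ.⊖ n ⟧ ≈ m • 1# - n • 1#
    ⟦⊖⟧ m 0 = trans (⟦+⟧ m) (sym (trans (+-congˡ -0#≈0#) (+-identityʳ _)))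
    ⟦⊖⟧ 0 (suc n) = sym (+-identityˡ _)
    ⟦⊖⟧ (suc m) (suc n) = begin
      ⟦ suc m ℤ.⊖ suc n ⟧      ≡⟨ ≡.cong ⟦_⟧ (ℤ.[1+m]⊖[1+n]≡m⊖n m n) ⟩
      ⟦ m ℤ.⊖ n ⟧              ≈⟨ ⟦⊖⟧ m n ⟩
      m • 1# - n • 1#          ≈⟨ sym (x+y-x+z 1# _ _) ⟩
      suc m • 1# - suc n • 1#  ∎

    neg-homo : ∀ i → ⟦ ℤ.- i ⟧ ≈ - ⟦ i ⟧
    neg-homo (+ 0)       = sym -0#≈0#
    neg-homo (+ suc n)   = -‿cong (sym (⟦+⟧ (suc n)))
    neg-homo (-[1+ n ])  = trans (⟦+⟧ (suc n)) (sym (-‿involutive _))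

    +-homo : ∀ i j → ⟦ i ℤ.+ j ⟧ ≈ ⟦ i ⟧ + ⟦ j ⟧
    +-homo (+ m) (+ n) = trans (⟦+⟧ (m ℕ.+ n))
      (trans (×-homo-+ 1# m n) (sym (+-cong (⟦+⟧ m) (⟦+⟧ n))))
    +-homo (+ m) (-[1+ n ]) = trans (⟦⊖⟧ m (suc n)) (+-congʳ (sym (⟦+⟧ m)))
    +-homo (-[1+ m ]) (+ n) = trans (⟦⊖⟧ n (suc m)) (trans (+-comm _ _) (+-congˡ (sym (⟦+⟧ n))))
    +-homo (-[1+ m ]) (-[1+ n ]) = begin
      - (suc (suc (m ℕ.+ n)) • 1#)        ≡⟨ ≡.cong (λ k → - (suc k • 1#)) (≡.sym (ℕ.+-suc m n)) ⟩
      - ((suc m ℕ.+ suc n) • 1#)          ≈⟨ -‿cong (×-homo-+ 1# (suc m) (suc n)) ⟩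
      - (suc m • 1# + suc n • 1#)         ≈⟨ sym (⁻¹-∙-comm _ _) ⟩
      - (suc m • 1#) + - (suc n • 1#)     ∎

    *-homo⁺ : ∀ m n → ⟦ + m ℤ.* + n ⟧ ≈ ⟦ + m ⟧ * ⟦ + n ⟧
    *-homo⁺ m n = begin
      ⟦ + m ℤ.* + n ⟧         ≡⟨ ≡.cong ⟦_⟧ (≡.sym (ℤ.pos-* m n)) ⟩
      ⟦ + (m ℕ.* n) ⟧         ≈⟨ ⟦+⟧ (m ℕ.* n) ⟩
      (m ℕ.* n) • 1#          ≈⟨ ×1-homo-* m n ⟩
      (m • 1#) * (n • 1#)     ≈⟨ sym (*-cong (⟦+⟧ m) (⟦+⟧ n)) ⟩
      ⟦ + m ⟧ * ⟦ + n ⟧       ∎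

    *-homo⁺ˡ : ∀ m j → ⟦ + m ℤ.* j ⟧ ≈ ⟦ + m ⟧ * ⟦ j ⟧
    *-homo⁺ˡ m (+ n) = *-homo⁺ m n
    *-homo⁺ˡ m (-[1+ n ]) = begin
      ⟦ + m ℤ.* ℤ.- (+ suc n) ⟧     ≡⟨ ≡.cong ⟦_⟧ (≡.sym (ℤ.neg-distribʳ-* (+ m) (+ suc n))) ⟩
      ⟦ ℤ.- (+ m ℤ.* + suc n) ⟧     ≈⟨ neg-homo (+ m ℤ.* + suc n) ⟩
      - ⟦ + m ℤ.* + suc n ⟧         ≈⟨ -‿cong (*-homo⁺ m (suc n)) ⟩
      - (⟦ + m ⟧ * ⟦ + suc n ⟧)     ≈⟨ -‿distribʳ-* _ _ ⟩
      ⟦ + m ⟧ * - ⟦ + suc n ⟧       ≈⟨ *-congˡ (-‿cong (⟦+⟧ (suc n))) ⟩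
      ⟦ + m ⟧ * ⟦ -[1+ n ] ⟧        ∎

    *-homo : ∀ i j → ⟦ i ℤ.* j ⟧ ≈ ⟦ i ⟧ * ⟦ j ⟧
    *-homo (+ m) j = *-homo⁺ˡ m j
    *-homo (-[1+ m ]) j = begin
      ⟦ ℤ.- (+ suc m) ℤ.* j ⟧       ≡⟨ ≡.cong ⟦_⟧ (≡.sym (ℤ.neg-distribˡ-* (+ suc m) j)) ⟩
      ⟦ ℤ.- (+ suc m ℤ.* j) ⟧       ≈⟨ neg-homo (+ suc m ℤ.* j) ⟩
      - ⟦ + suc m ℤ.* j ⟧           ≈⟨ -‿cong (*-homo⁺ˡ (suc m) j) ⟩
      - (⟦ + suc m ⟧ * ⟦ j ⟧)       ≈⟨ -‿distribˡ-* _ _ ⟩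
      - ⟦ + suc m ⟧ * ⟦ j ⟧         ≈⟨ *-congʳ (-‿cong (⟦+⟧ (suc m))) ⟩
      ⟦ -[1+ m ] ⟧ * ⟦ j ⟧          ∎

    morphism : ℤ.+-*-rawRing -Raw-AlmostCommutative⟶ fromCommutativeRing R
    morphism = record
      { ⟦_⟧    = ⟦_⟧
      ; +-homo = +-homo
      ; *-homo = *-homo
      ; -‿homo = neg-homo
      ; 0-homo = refl
      ; 1-homo = refl
      }

    _coeff≟_ : ∀ i j → Maybe (⟦ i ⟧ ≈ ⟦ j ⟧)
    i coeff≟ j with i ℤ.≟ j
    ... | yes i≡j = just (reflexive (≡.cong ⟦_⟧ i≡j))
    ... | no  _   = nothing

  open RingSolver ℤ.+-*-rawRing (fromCommutativeRing R) morphism _coeff≟_ public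
    using (solve; con; _:=_; _:+_; _:*_; _:-_; :-_; Polynomial)

  :# : ∀ {m} → ℕ → Polynomial m
  :# n = con (+ n)

-- Ordered-field arithmetic and square roots.

module Reals (F : CompleteOrderedField) where
  open CompleteOrderedField F public hiding (zero)
  open SquareRoot F public
  open IntegerRingSolver commutativeRing public
  open SemiringMult semiring public using (×-homo-+; ×1-homo-*)
  open Order public using (total; antisym; _≟_)
    renaming (trans to ≤-trans; refl to ≤-refl; reflexive to ≤-reflexive)

  0≤+ : ∀ {x y} → 0# ≤ x → 0# ≤ y → 0# ≤ x + y
  0≤+ p q = ≤-resp (+-identityˡ 0#) refl (+-mono-≤ p q)

  0≤fromℕ : ∀ n → 0# ≤ fromℕ n
  0≤fromℕ zero    = ≤-refl
  0≤fromℕ (suc n) = 0≤+ 0≤1 (0≤fromℕ n)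

  fromℕ-mono-≤ : ∀ {m n} → m ℕ.≤ n → fromℕ m ≤ fromℕ n
  fromℕ-mono-≤ {n = n} z≤n = 0≤fromℕ n
  fromℕ-mono-≤ (s≤s m≤n)   = +-monoʳ-≤ 1# (fromℕ-mono-≤ m≤n)

  fromℕ-suc≉0 : ∀ n → ¬ (fromℕ (suc n) ≈ 0#)
  fromℕ-suc≉0 n eq = 0≉1 (antisym 0≤1
    (≤-resp (+-identityʳ 1#) eq (+-monoʳ-≤ 1# (0≤fromℕ n))))

  0≤k*x : ∀ k {x} → 0# ≤ x → 0# ≤ fromℕ k * x
  0≤k*x k = *-nonNeg (0≤fromℕ k)

  y-x≈z⇒x≤y : ∀ {x y z} → y - x ≈ z → 0# ≤ z → x ≤ y
  y-x≈z⇒x≤y eq 0≤z = 0≤y-x⇒x≤y (≤-resp refl (sym eq) 0≤z)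

  x≤k*y⇒x/k≤y : ∀ {x y} n → x ≤ fromℕ (suc n) * y → x / fromℕ (suc n) ≤ y
  x≤k*y⇒x/k≤y {x} n p = *-cancelˡ-≤ (fromℕ (suc n)) (0≤fromℕ (suc n)) (fromℕ-suc≉0 n)
    (≤-resp (sym (*-/ (fromℕ (suc n)) x (fromℕ-suc≉0 n))) refl p)

  -- The ring solver proves only polynomial identities. An equation that holds modulo a relation
  -- `l ≈ r` is given to it with an explicit cofactor `k`, and the multiple of `l - r` is then
  -- discarded.
  x≈y+k[l-r]⇒x≈y : ∀ {x y k l r} → l ≈ r → x ≈ y + k * (l - r) → x ≈ y
  x≈y+k[l-r]⇒x≈y {x} {y} {k} {l} {r} l≈r eq = trans eq (trans (+-congˡ k[l-r]≈0) (+-identityʳ y))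
    where
    k[l-r]≈0 : k * (l - r) ≈ 0#
    k[l-r]≈0 = trans (*-congˡ (trans (+-congʳ l≈r) (-‿inverseʳ r))) (zeroʳ k)

  ²-mono-≤ : ∀ {x y} → 0# ≤ x → x ≤ y → x * x ≤ y * y
  ²-mono-≤ {x} {y} 0≤x x≤y = ≤-trans (*-monoˡ-≤ x 0≤x x≤y)
    (≤-resp (*-comm y x) refl (*-monoˡ-≤ y (≤-trans 0≤x x≤y) x≤y))

  ²-cancel-≤ : ∀ {x y} → 0# ≤ y → x * x ≤ y * y → x ≤ y
  ²-cancel-≤ {x} {y} 0≤y x²≤y² with total x y
  ... | inj₁ x≤y = x≤y
  ... | inj₂ y≤x with x ≟ 0#
  ...   | yes x≈0 = ≤-resp (sym x≈0) refl 0≤y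
  ...   | no  x≉0 = *-cancelˡ-≤ x (≤-trans 0≤y y≤x) x≉0
    (≤-trans x²≤y² (≤-resp (*-comm y y) (*-comm y x) (*-monoˡ-≤ y 0≤y y≤x)))

  √-nonNeg : ∀ a → 0# ≤ √ a
  √-nonNeg a with 0# Order.≤? a
  ... | yes 0≤a = proj₁ (proj₂ (sqrt a 0≤a))
  ... | no  _   = ≤-refl

  √-square : ∀ {a} → 0# ≤ a → √ a * √ a ≈ a
  √-square {a} 0≤a with 0# Order.≤? a
  ... | yes 0≤a′ = proj₂ (proj₂ (sqrt a 0≤a′))
  ... | no  0≰a  = contradiction 0≤a 0≰a

  ½ √3 : ℝ
  ½  = 1# / fromℕ 2
  √3 = √ (fromℕ 3)

  infix 4 ¼≤_
  ¼≤_ : ℝ → Set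
  ¼≤ x = ½ * ½ ≤ x

  ½+½≈1 : ½ + ½ ≈ 1#
  ½+½≈1 = trans (solve 1 (λ c → c :+ c := :# 2 :* c) refl ½) (*-/ (fromℕ 2) 1# (fromℕ-suc≉0 1))

  0≤½ : 0# ≤ ½
  0≤½ = *-cancelˡ-≤ (fromℕ 2) (0≤fromℕ 2) (fromℕ-suc≉0 1)
    (≤-resp (sym (zeroʳ (fromℕ 2))) (sym (*-/ (fromℕ 2) 1# (fromℕ-suc≉0 1))) 0≤1)

  √3*√3≈3 : √3 * √3 ≈ fromℕ 3
  √3*√3≈3 = √-square (0≤fromℕ 3)

-- Numerical comparison of the thresholds for d.

module Thresholds (F : CompleteOrderedField) where
  open Reals F

  √2 √5 ⅟√2 ⅟√5 : ℝ
  √2 = √ (fromℕ 2)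
  √5 = √ (fromℕ 5)
  ⅟√2 = √2 ⁻¹
  ⅟√5 = √5 ⁻¹

  k*[y-x]≈z⇒x≤y : ∀ n {x y z} → fromℕ (suc n) * (y - x) ≈ z → 0# ≤ z → x ≤ y
  k*[y-x]≈z⇒x≤y n eq 0≤z = 0≤y-x⇒x≤y
    (*-cancelˡ-≤ (fromℕ (suc n)) (0≤fromℕ (suc n)) (fromℕ-suc≉0 n)
      (≤-resp (sym (zeroʳ _)) (sym eq) 0≤z))

  module _ (n : ℕ) where
    private
      r : ℝ
      r = √ (fromℕ (suc n))

    √suc*√suc≈suc : r * r ≈ fromℕ (suc n)
    √suc*√suc≈suc = √-square (0≤fromℕ (suc n))

    √suc≉0 : ¬ (r ≈ 0#)
    √suc≉0 r≈0 = fromℕ-suc≉0 n (trans (sym √suc*√suc≈suc) (trans (*-congˡ r≈0) (zeroʳ r)))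

    0≤⅟√suc : 0# ≤ r ⁻¹
    0≤⅟√suc = *-cancelˡ-≤ r (√-nonNeg (fromℕ (suc n))) √suc≉0
      (≤-resp (sym (zeroʳ r)) (sym (⁻¹-inverseʳ r √suc≉0)) 0≤1)

    suc*⅟√suc²≈1 : fromℕ (suc n) * (r ⁻¹ * r ⁻¹) ≈ 1#
    suc*⅟√suc²≈1 = trans (*-congʳ (sym √suc*√suc≈suc))
      (trans (solve 2 (λ x y → (x :* x) :* (y :* y) := (x :* y) :* (x :* y)) refl r (r ⁻¹))
      (trans (*-cong (⁻¹-inverseʳ r √suc≉0) (⁻¹-inverseʳ r √suc≉0)) (*-identityˡ 1#)))

  -- The thresholds are compared by means of the rational bounds √3 ≤ 7/4, √3 ≤ 26/15, 7/10 ≤ 1/√2 ≤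
  -- 3/4 and 4/9 ≤ 1/√5 ≤ 1/2. With the denominators of the bounds cleared, the squares of the two
  -- sides differ by exactly 1, or by 1/5 in the case of √5.
  0≤7-4√3 : 0# ≤ fromℕ 7 - fromℕ 4 * √3
  0≤7-4√3 = x≤y⇒0≤y-x (²-cancel-≤ (0≤fromℕ 7)
    (y-x≈z⇒x≤y (x≈y+k[l-r]⇒x≈y {k = - fromℕ 16} √3*√3≈3
      (solve 1 (λ r → :# 7 :* :# 7 :- (:# 4 :* r) :* (:# 4 :* r)
        := :# 1 :+ (:- :# 16) :* (r :* r :- :# 3)) refl √3))
      0≤1))

  0≤26-15√3 : 0# ≤ fromℕ 26 - fromℕ 15 * √3
  0≤26-15√3 = x≤y⇒0≤y-x (²-cancel-≤ (0≤fromℕ 26)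
    (y-x≈z⇒x≤y (x≈y+k[l-r]⇒x≈y {k = - fromℕ 225} √3*√3≈3
      (solve 1 (λ r → :# 26 :* :# 26 :- (:# 15 :* r) :* (:# 15 :* r)
        := :# 1 :+ (:- :# 225) :* (r :* r :- :# 3)) refl √3))
      0≤1))

  0≤3-√3 : 0# ≤ fromℕ 3 - √3
  0≤3-√3 = x≤y⇒0≤y-x (k*[y-x]≈z⇒x≤y 3
    (solve 1 (λ r → :# 4 :* (:# 3 :- r) := (:# 7 :- :# 4 :* r) :+ :# 5) refl √3)
    (0≤+ 0≤7-4√3 (0≤fromℕ 5)))

  0≤10⅟√2-7 : 0# ≤ fromℕ 10 * ⅟√2 - fromℕ 7
  0≤10⅟√2-7 = x≤y⇒0≤y-x (²-cancel-≤ (0≤k*x 10 (0≤⅟√suc 1))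
    (y-x≈z⇒x≤y (x≈y+k[l-r]⇒x≈y {k = fromℕ 50} (suc*⅟√suc²≈1 1)
      (solve 1 (λ v → (:# 10 :* v) :* (:# 10 :* v) :- :# 7 :* :# 7
        := :# 1 :+ :# 50 :* (:# 2 :* (v :* v) :- :# 1)) refl ⅟√2))
      0≤1))

  0≤3-4⅟√2 : 0# ≤ fromℕ 3 - fromℕ 4 * ⅟√2
  0≤3-4⅟√2 = x≤y⇒0≤y-x (²-cancel-≤ (0≤fromℕ 3)
    (y-x≈z⇒x≤y (x≈y+k[l-r]⇒x≈y {k = - fromℕ 8} (suc*⅟√suc²≈1 1)
      (solve 1 (λ v → :# 3 :* :# 3 :- (:# 4 :* v) :* (:# 4 :* v)
        := :# 1 :+ (:- :# 8) :* (:# 2 :* (v :* v) :- :# 1)) refl ⅟√2))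
      0≤1))

  0≤9⅟√5-4 : 0# ≤ fromℕ 9 * ⅟√5 - fromℕ 4
  0≤9⅟√5-4 = x≤y⇒0≤y-x (²-cancel-≤ (0≤k*x 9 (0≤⅟√suc 4))
    (k*[y-x]≈z⇒x≤y 4 (x≈y+k[l-r]⇒x≈y {k = fromℕ 81} (suc*⅟√suc²≈1 4)
      (solve 1 (λ q → :# 5 :* ((:# 9 :* q) :* (:# 9 :* q) :- :# 4 :* :# 4)
        := :# 1 :+ :# 81 :* (:# 5 :* (q :* q) :- :# 1)) refl ⅟√5))
      0≤1))

  0≤1-2⅟√5 : 0# ≤ 1# - fromℕ 2 * ⅟√5
  0≤1-2⅟√5 = x≤y⇒0≤y-x (²-cancel-≤ 0≤1
    (k*[y-x]≈z⇒x≤y 4 (x≈y+k[l-r]⇒x≈y {k = - fromℕ 4} (suc*⅟√suc²≈1 4)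
      (solve 1 (λ q → :# 5 :* (:# 1 :* :# 1 :- (:# 2 :* q) :* (:# 2 :* q))
        := :# 1 :+ (:- :# 4) :* (:# 5 :* (q :* q) :- :# 1)) refl ⅟√5))
      0≤1))

  4½½y≈y : ∀ y → fromℕ 4 * (½ * ½ * y) ≈ y
  4½½y≈y y = x≈y+k[l-r]⇒x≈y {k = (½ + ½ + 1#) * y} ½+½≈1
    (solve 2 (λ c y → :# 4 :* (c :* c :* y)
      := y :+ (c :+ c :+ :# 1) :* y :* (c :+ c :- :# 1)) refl ½ y)

  4x≤y⇒x≤½½y : ∀ {x y} → fromℕ 4 * x ≤ y → x ≤ ½ * ½ * y
  4x≤y⇒x≤½½y {x} {y} p = *-cancelˡ-≤ (fromℕ 4) (0≤fromℕ 4) (fromℕ-suc≉0 3)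
    (≤-resp refl (sym (4½½y≈y y)) p)

  y≤4x⇒½½y≤x : ∀ {x y} → y ≤ fromℕ 4 * x → ½ * ½ * y ≤ x
  y≤4x⇒½½y≤x {x} {y} p = *-cancelˡ-≤ (fromℕ 4) (0≤fromℕ 4) (fromℕ-suc≉0 3)
    (≤-resp (sym (4½½y≈y y)) refl p)

  -- Up to the factor 1/4 in the first two, these are the squares of the thresholds. The
  -- inequalities below place all six ranges of d² inside [1/4, (5-2√3)/4] or [(5+2√3)/4, ∞).
  5-2√3 5+2√3 α⁻ α⁺ β⁻ β⁺ : ℝ
  5-2√3 = fromℕ 5 - fromℕ 2 * √3
  5+2√3 = fromℕ 5 + fromℕ 2 * √3
  α⁻ = (fromℕ 3 - √3) * (1# - 1# / √2)
  α⁺ = (fromℕ 3 - √3) * (1# + 1# / √2)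
  β⁻ = fromℕ 19 / fromℕ 15 - fromℕ 2 / √5
  β⁺ = fromℕ 19 / fromℕ 15 + fromℕ 2 / √5

  private
    15*19/15≈19 : fromℕ 15 * (fromℕ 19 / fromℕ 15) ≈ fromℕ 19
    15*19/15≈19 = *-/ (fromℕ 15) (fromℕ 19) (fromℕ-suc≉0 14)

  -- As in the next comparisons, a multiple of the difference is written as a nonnegative
  -- combination of rational bounds: first 1/√2 (or 1/√5) is replaced by its bound, then √3 wherever
  -- it remains.
  1≤4α⁻ : 1# ≤ fromℕ 4 * α⁻
  1≤4α⁻ = k*[y-x]≈z⇒x≤y 3
    (solve 2 (λ r v → :# 4 :* (:# 4 :* ((:# 3 :- r) :* (:# 1 :- :# 1 :* v)) :- :# 1)
      := :# 4 :* ((:# 3 :- r) :* (:# 3 :- :# 4 :* v)) :+ (:# 7 :- :# 4 :* r) :+ :# 1) refl √3 ⅟√2)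
    (0≤+ (0≤+ (0≤k*x 4 (*-nonNeg 0≤3-√3 0≤3-4⅟√2)) 0≤7-4√3) 0≤1)

  4α⁻≤5-2√3 : fromℕ 4 * α⁻ ≤ 5-2√3
  4α⁻≤5-2√3 = k*[y-x]≈z⇒x≤y 9
    (solve 2 (λ r v → :# 10 :* ((:# 5 :- :# 2 :* r) :- :# 4 :* ((:# 3 :- r) :* (:# 1 :- :# 1 :* v)))
      := :# 4 :* ((:# 3 :- r) :* (:# 10 :* v :- :# 7)) :+ :# 2 :* (:# 7 :- :# 4 :* r)) refl √3 ⅟√2)
    (0≤+ (0≤k*x 4 (*-nonNeg 0≤3-√3 0≤10⅟√2-7)) (0≤k*x 2 0≤7-4√3))

  5+2√3≤4α⁺ : 5+2√3 ≤ fromℕ 4 * α⁺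
  5+2√3≤4α⁺ = k*[y-x]≈z⇒x≤y 9
    (solve 2 (λ r v → :# 10 :* (:# 4 :* ((:# 3 :- r) :* (:# 1 :+ :# 1 :* v)) :- (:# 5 :+ :# 2 :* r))
      := :# 4 :* ((:# 3 :- r) :* (:# 10 :* v :- :# 7)) :+ :# 22 :* (:# 7 :- :# 4 :* r)) refl √3 ⅟√2)
    (0≤+ (0≤k*x 4 (*-nonNeg 0≤3-√3 0≤10⅟√2-7)) (0≤k*x 22 0≤7-4√3))

  1≤4β⁻ : 1# ≤ fromℕ 4 * β⁻
  1≤4β⁻ = k*[y-x]≈z⇒x≤y 14
    (x≈y+k[l-r]⇒x≈y {k = fromℕ 4} 15*19/15≈19
      (solve 2 (λ e q → :# 15 :* (:# 4 :* (e :- :# 2 :* q) :- :# 1)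
        := (:# 60 :* (:# 1 :- :# 2 :* q) :+ :# 1) :+ :# 4 :* (:# 15 :* e :- :# 19))
        refl (fromℕ 19 / fromℕ 15) ⅟√5))
    (0≤+ (0≤k*x 60 0≤1-2⅟√5) 0≤1)

  4β⁻≤5-2√3 : fromℕ 4 * β⁻ ≤ 5-2√3
  4β⁻≤5-2√3 = k*[y-x]≈z⇒x≤y 44
    (x≈y+k[l-r]⇒x≈y {k = - fromℕ 12} 15*19/15≈19
      (solve 3 (λ e q r → :# 45 :* ((:# 5 :- :# 2 :* r) :- :# 4 :* (e :- :# 2 :* q))
        := (:# 40 :* (:# 9 :* q :- :# 4) :+ :# 6 :* (:# 26 :- :# 15 :* r) :+ :# 1) :+ (:- :# 12) :* (:# 15 :* e :- :# 19))
        refl (fromℕ 19 / fromℕ 15) ⅟√5 √3))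
    (0≤+ (0≤+ (0≤k*x 40 0≤9⅟√5-4) (0≤k*x 6 0≤26-15√3)) 0≤1)

  5+2√3≤4β⁺ : 5+2√3 ≤ fromℕ 4 * β⁺
  5+2√3≤4β⁺ = k*[y-x]≈z⇒x≤y 44
    (x≈y+k[l-r]⇒x≈y {k = fromℕ 12} 15*19/15≈19
      (solve 3 (λ e q r → :# 45 :* (:# 4 :* (e :+ :# 2 :* q) :- (:# 5 :+ :# 2 :* r))
        := (:# 40 :* (:# 9 :* q :- :# 4) :+ :# 6 :* (:# 26 :- :# 15 :* r) :+ :# 7) :+ :# 12 :* (:# 15 :* e :- :# 19))
        refl (fromℕ 19 / fromℕ 15) ⅟√5 √3))
    (0≤+ (0≤+ (0≤k*x 40 0≤9⅟√5-4) (0≤k*x 6 0≤26-15√3)) (0≤fromℕ 7))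

  1≤5+2√3 : 1# ≤ 5+2√3
  1≤5+2√3 = y-x≈z⇒x≤y (solve 1 (λ r → (:# 5 :+ :# 2 :* r) :- :# 1 := :# 4 :+ :# 2 :* r) refl √3)
    (0≤+ (0≤fromℕ 4) (0≤k*x 2 (√-nonNeg (fromℕ 3))))

  0≤5-2√3 : 0# ≤ 5-2√3
  0≤5-2√3 = ≤-trans 0≤1 (≤-trans 1≤4α⁻ 4α⁻≤5-2√3)

  -- With n = d², this says that √(d² - 1/4) and √3/2 differ by at least 1/2.
  Admissible : ℝ → Set
  Admissible n = ¼≤ n × (n ≤ ½ * ½ * 5-2√3 ⊎ ½ * ½ * 5+2√3 ≤ n)

  private
    1≤4x⇒¼≤x : ∀ {x} → 1# ≤ fromℕ 4 * x → ¼≤ x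
    1≤4x⇒¼≤x p = ≤-resp (*-identityʳ _) refl (y≤4x⇒½½y≤x p)

    0≤ : ∀ {x} → 1# ≤ fromℕ 4 * x → 0# ≤ x
    0≤ p = ≤-trans (0≤x² ½) (1≤4x⇒¼≤x p)

  module _ {d : ℝ} (0≤d : 0# ≤ d) where
    d≤√a⇒d²≤a : ∀ {a} → 0# ≤ a → d ≤ √ a → d * d ≤ a
    d≤√a⇒d²≤a 0≤a p = ≤-resp refl (√-square 0≤a) (²-mono-≤ 0≤d p)

    √a≤d⇒a≤d² : ∀ {a} → 0# ≤ a → √ a ≤ d → a ≤ d * d
    √a≤d⇒a≤d² {a} 0≤a p = ≤-resp (√-square 0≤a) refl (²-mono-≤ (√-nonNeg a) p)

    private
      ½½√√ : ∀ {a} → 0# ≤ a → (½ * √ a) * (½ * √ a) ≈ ½ * ½ * a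
      ½½√√ {a} 0≤a = trans (solve 2 (λ c y → (c :* y) :* (c :* y)
        := c :* c :* (y :* y)) refl ½ (√ a))
        (*-congˡ (√-square 0≤a))

      large : ½ * ½ * 5+2√3 ≤ d * d → Admissible (d * d)
      large p = ≤-trans (1≤4x⇒¼≤x (≤-resp refl (sym (4½½y≈y 5+2√3)) 1≤5+2√3)) p , inj₂ p

    admissible₁ : ½ ≤ d → d ≤ √ α⁻ → Admissible (d * d)
    admissible₁ p q = ²-mono-≤ 0≤½ p ,
      inj₁ (≤-trans (d≤√a⇒d²≤a (0≤ 1≤4α⁻) q) (4x≤y⇒x≤½½y 4α⁻≤5-2√3))

    admissible₂ : √ α⁻ ≤ d → d ≤ √ β⁻ → Admissible (d * d)
    admissible₂ p q = ≤-trans (1≤4x⇒¼≤x 1≤4α⁻) (√a≤d⇒a≤d² (0≤ 1≤4α⁻) p) ,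
      inj₁ (≤-trans (d≤√a⇒d²≤a (0≤ 1≤4β⁻) q) (4x≤y⇒x≤½½y 4β⁻≤5-2√3))

    admissible₃ : √ β⁻ ≤ d → d ≤ ½ * √ 5-2√3 → Admissible (d * d)
    admissible₃ p q = ≤-trans (1≤4x⇒¼≤x 1≤4β⁻) (√a≤d⇒a≤d² (0≤ 1≤4β⁻) p) ,
      inj₁ (≤-resp refl (½½√√ 0≤5-2√3) (²-mono-≤ 0≤d q))

    admissible₄ : ½ * √ 5+2√3 ≤ d → Admissible (d * d)
    admissible₄ p = large (≤-resp (½½√√ (≤-trans 0≤1 1≤5+2√3)) refl
      (²-mono-≤ (*-nonNeg 0≤½ (√-nonNeg 5+2√3)) p))

    admissible₅ : √ β⁺ ≤ d → Admissible (d * d)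
    admissible₅ p = large (≤-trans (y≤4x⇒½½y≤x 5+2√3≤4β⁺)
      (√a≤d⇒a≤d² (0≤ (≤-trans 1≤5+2√3 5+2√3≤4β⁺)) p))

    admissible₆ : √ α⁺ ≤ d → Admissible (d * d)
    admissible₆ p = large (≤-trans (y≤4x⇒½½y≤x 5+2√3≤4α⁺)
      (√a≤d⇒a≤d² (0≤ (≤-trans 1≤5+2√3 5+2√3≤4α⁺)) p))

-- Finite additivity: from pointwise counts to inequalities between expectations.

module FiniteAdditivity (F : CompleteOrderedField) (G : Group 0ℓ 0ℓ)
  (m : Measure.LeftInvariantProbability F G) where
  open Reals F hiding (total; _⁻¹)
  open Measure F G
  open LeftInvariantProbability m
  open Group G using (Carrier; _⁻¹; _∙_; assoc; ∙-congˡ; ∙-congʳ; inverseˡ; inverseʳ; identityˡ)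
    renaming (_≈_ to _≈ᴳ_; sym to symᴳ; trans to transᴳ)

  -- Decidable membership is what allows an arbitrary set to be split along an event constructively.
  record Event : Set₁ where
    field
      set  : Subset
      _∈?_ : ∀ g → Dec (g ∈ pred set)
  open Event public

  infixl 7 _∩ˢ_ _∖ˢ_
  _∩ˢ_ _∖ˢ_ : Subset → Subset → Subset
  A ∩ˢ B = mkSubset (λ g → g ∈ pred A × g ∈ pred B)
    λ g≈h (a , b) → respects A g≈h a , respects B g≈h b
  A ∖ˢ B = mkSubset (λ g → g ∈ pred A × g ∉ pred B)
    λ g≈h (a , ¬b) → respects A g≈h a , λ b → ¬b (respects B (symᴳ g≈h) b)

  -- An empty set is disjoint from itself, so additivity gives `μ A ≈ μ A + μ A`.
  μ-empty : ∀ A → (∀ g → g ∉ pred A) → μ A ≈ 0#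
  μ-empty A empty = x≈x+x⇒x≈0 (trans
    (cong A (A ∪ˢ A) (inj₁ , [ (λ a → a) , (λ a → a) ]′))
    (additive A A λ (a , _) → empty _ a))
    where
    x≈x+x⇒x≈0 : ∀ {x} → x ≈ x + x → x ≈ 0#
    x≈x+x⇒x≈0 {x} eq = x≈y+k[l-r]⇒x≈y {k = - 1#} eq
      (solve 1 (λ x → x := :# 0 :+ (:- :# 1) :* (x :- (x :+ x))) refl x)

  -- Left invariance in terms of preimages: the two hypotheses make `B` equal to `g · A`.
  μ-shift : ∀ g A B → (∀ h → h ∈ pred B → g ⁻¹ ∙ h ∈ pred A) →
            (∀ h → g ⁻¹ ∙ h ∈ pred A → h ∈ pred B) → μ B ≈ μ A
  μ-shift g A B B⇒A A⇒B = trans (cong B (g · A) (to , from)) (leftInvariant g A)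
    where
    to : ∀ {h} → h ∈ pred B → h ∈ pred (g · A)
    to {h} h∈B = _ , B⇒A h h∈B , symᴳ (cancel h)
      where
      cancel : ∀ h → g ∙ (g ⁻¹ ∙ h) ≈ᴳ h
      cancel h = transᴳ (symᴳ (assoc g (g ⁻¹) h))
        (transᴳ (∙-congʳ (inverseʳ g)) (identityˡ h))
    from : ∀ {h} → h ∈ pred (g · A) → h ∈ pred B
    from {h} (x , x∈A , h≈gx) = A⇒B h (respects A (symᴳ g⁻¹h≈x) x∈A)
      where
      g⁻¹h≈x : g ⁻¹ ∙ h ≈ᴳ x
      g⁻¹h≈x = transᴳ (∙-congˡ h≈gx) (transᴳ (symᴳ (assoc (g ⁻¹) g x))
        (transᴳ (∙-congʳ (inverseˡ g)) (identityˡ x)))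

  module _ (E : Event) where
    μ-split : ∀ C → μ C ≈ μ (C ∩ˢ set E) + μ (C ∖ˢ set E)
    μ-split C = trans (cong C _ (split , [ proj₁ , proj₁ ]′))
      (additive _ _ λ ((_ , e) , (_ , ¬e)) → ¬e e)
      where
      split : ∀ {g} → g ∈ pred C → g ∈ pred ((C ∩ˢ set E) ∪ˢ (C ∖ˢ set E))
      split {g} c with _∈?_ E g
      ... | yes e = inj₁ (c , e)
      ... | no ¬e = inj₂ (c , ¬e)

    μ-split-∩ : ∀ C X → μ (C ∩ˢ X) ≈ μ (C ∩ˢ set E ∩ˢ X) + μ (C ∖ˢ set E ∩ˢ X)
    μ-split-∩ C X = trans (μ-split (C ∩ˢ X)) (+-cong
      (cong _ _ ((λ ((c , x) , e) → (c , e) , x) , (λ ((c , e) , x) → (c , x) , e)))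
      (cong _ _ ((λ ((c , x) , e) → (c , e) , x) , (λ ((c , e) , x) → (c , x) , e))))

  count : List (ℕ × Event) → Carrier → ℕ
  count []             g = 0
  count ((k , E) ∷ es) g = (if does (_∈?_ E g) then k else 0) ℕ.+ count es g

  -- The integral of `count es` over `C`.
  mass : Subset → List (ℕ × Event) → ℝ
  mass C []             = 0#
  mass C ((k , E) ∷ es) = fromℕ k * μ (C ∩ˢ set E) + mass C es

  private
    mass-split : ∀ E C es → mass C es ≈ mass (C ∩ˢ set E) es + mass (C ∖ˢ set E) es
    mass-split E C []             = sym (+-identityˡ 0#)
    mass-split E C ((k , X) ∷ es) = trans
      (+-cong (*-congˡ (μ-split-∩ E C (set X))) (mass-split E C es))
      (solve 5 (λ k u v x y → k :* (u :+ v) :+ (x :+ y) := (k :* u :+ x) :+ (k :* v :+ y)) refl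
        _ _ _ _ _)

    step : ∀ E C k a es →
      fromℕ a * μ C + mass C ((k , E) ∷ es) ≈
      (fromℕ (a ℕ.+ k) * μ (C ∩ˢ set E) + mass (C ∩ˢ set E) es) +
      (fromℕ a * μ (C ∖ˢ set E) + mass (C ∖ˢ set E) es)
    step E C k a es = trans
      (+-cong (*-congˡ (μ-split E C)) (+-congˡ (mass-split E C es)))
      (trans (solve 6 (λ a k u v x y → a :* (u :+ v) :+ (k :* u :+ (x :+ y)) :=
                                     ((a :+ k) :* u :+ x) :+ (a :* v :+ y)) refl
                (fromℕ a) (fromℕ k) _ _ _ _)
             (+-congʳ (+-congʳ (*-congʳ (sym (×-homo-+ 1# a k))))))

    count-∈ : ∀ a k E es {g} → g ∈ pred (set E) →
              a ℕ.+ count ((k , E) ∷ es) g ≡.≡ (a ℕ.+ k) ℕ.+ count es g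
    count-∈ a k E es {g} e with _∈?_ E g
    ... | yes _ = ≡.sym (ℕ.+-assoc a k _)
    ... | no ¬e = contradiction e ¬e

    count-∉ : ∀ a k E es {g} → g ∉ pred (set E) →
              a ℕ.+ count ((k , E) ∷ es) g ≡.≡ a ℕ.+ count es g
    count-∉ a k E es {g} ¬e with _∈?_ E g
    ... | yes e = contradiction e ¬e
    ... | no _  = ≡.refl

    -- Induction on the lists, splitting `C` along the head event. Inside the event its weight joins
    -- the constant `a` or `b`; outside it the weight disappears. Once both lists are empty, only
    -- constants are compared.
    offset-mass-mono : ∀ C a b es fs →
      (∀ g → g ∈ pred C → a ℕ.+ count es g ℕ.≤ b ℕ.+ count fs g) →
      fromℕ a * μ C + mass C es ≤ fromℕ b * μ C + mass C fs
    offset-mass-mono C a b [] [] h = +-monoˡ-≤ 0# aμ≤bμ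
      where
      aμ≤bμ : fromℕ a * μ C ≤ fromℕ b * μ C
      aμ≤bμ with a ℕ.≤? b
      ... | yes a≤b = ≤-resp (*-comm _ _) (*-comm _ _)
                        (*-monoˡ-≤ (μ C) (nonNeg C) (fromℕ-mono-≤ a≤b))
      -- Here the pointwise hypothesis fails everywhere, so `C` is empty and both sides are 0.
      ... | no  a≰b = ≤-reflexive (trans (vanish a) (sym (vanish b)))
        where
        empty : ∀ g → g ∉ pred C
        empty g c = a≰b (≡.subst₂ ℕ._≤_ (ℕ.+-identityʳ a) (ℕ.+-identityʳ b) (h g c))
        vanish : ∀ k → fromℕ k * μ C ≈ 0#
        vanish k = trans (*-congˡ (μ-empty C empty)) (zeroʳ (fromℕ k))
    offset-mass-mono C a b ((k , E) ∷ es) fs h = ≤-resp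
      (sym (step E C k a es))
      (trans (solve 5 (λ b u v x y → (b :* u :+ x) :+ (b :* v :+ y)
        := b :* (u :+ v) :+ (x :+ y)) refl
                (fromℕ b) _ _ _ _)
             (sym (+-cong (*-congˡ (μ-split E C)) (mass-split E C fs))))
      (+-mono-≤
        (offset-mass-mono (C ∩ˢ set E) (a ℕ.+ k) b es fs λ g (c , e) →
          ℕ.≤-trans (ℕ.≤-reflexive (≡.sym (count-∈ a k E es e))) (h g c))
        (offset-mass-mono (C ∖ˢ set E) a b es fs λ g (c , ¬e) →
          ℕ.≤-trans (ℕ.≤-reflexive (≡.sym (count-∉ a k E es ¬e))) (h g c)))
    offset-mass-mono C a b [] ((k , E) ∷ fs) h = ≤-resp
      (trans (solve 3 (λ a u v → (a :* u :+ :# 0) :+ (a :* v :+ :# 0) := a :* (u :+ v) :+ :# 0) refl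
                (fromℕ a) _ _)
             (sym (+-congʳ (*-congˡ (μ-split E C)))))
      (sym (step E C k b fs))
      (+-mono-≤
        (offset-mass-mono (C ∩ˢ set E) a (b ℕ.+ k) [] fs λ g (c , e) →
          ℕ.≤-trans (h g c) (ℕ.≤-reflexive (count-∈ b k E fs e)))
        (offset-mass-mono (C ∖ˢ set E) a b [] fs λ g (c , ¬e) →
          ℕ.≤-trans (h g c) (ℕ.≤-reflexive (count-∉ b k E fs ¬e))))

  expected : List (ℕ × Event) → ℝ
  expected []             = 0#
  expected ((k , E) ∷ es) = fromℕ k * μ (set E) + expected es

  private
    mass-whole : ∀ es → mass whole es ≈ expected es
    mass-whole []             = refl
    mass-whole ((k , E) ∷ es) = +-cong (*-congˡ (cong _ _ (proj₂ , (tt ,_)))) (mass-whole es)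

  expected-mono : ∀ es fs → (∀ g → count es g ℕ.≤ count fs g) → expected es ≤ expected fs
  expected-mono es fs h = ≤-resp (unit es) (unit fs)
    (offset-mass-mono whole 0 0 es fs λ g _ → h g)
    where
    unit : ∀ es → 0# * μ whole + mass whole es ≈ expected es
    unit es = trans (+-cong (zeroˡ _) (mass-whole es)) (+-identityˡ _)

-- Isometries of the plane in coordinates.

module Motions (F : CompleteOrderedField) where
  open Reals F
  open Plane F public hiding (√; √-cong)
  open Setoid plane public using () renaming (refl to ≈ₚ-refl; trans to ≈ₚ-trans)

  -- Squared distances are polynomials in the coordinates and thus within reach of the ring solver.
  sq : Point → Point → ℝ
  sq (x , y) (x′ , y′) = (x - x′) * (x - x′) + (y - y′) * (y - y′)

  0≤sq : ∀ A B → 0# ≤ sq A B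
  0≤sq _ _ = 0≤+ (0≤x² _) (0≤x² _)

  dist²≈sq : ∀ A B → dist A B * dist A B ≈ sq A B
  dist²≈sq A B = √-square (0≤sq A B)

  private
    modulo₂ : ∀ {x y k k′ l l′ r r′} → l ≈ r → l′ ≈ r′ →
              x ≈ y + k * (l - r) + k′ * (l′ - r′) → x ≈ y
    modulo₂ eq eq′ p = x≈y+k[l-r]⇒x≈y eq (x≈y+k[l-r]⇒x≈y eq′ p)

  -- The orthogonal matrix with columns (c , s) and δ (- s , c), applied about A
  -- and followed by the translation taking A to A′.
  module _ {c s δ : ℝ} (unit : c * c + s * s ≈ 1#) (sign : δ * δ ≈ 1#) (A A′ : Point) where
    private
      a b a′ b′ : ℝ
      a  = proj₁ A
      b  = proj₂ A
      a′ = proj₁ A′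
      b′ = proj₂ A′

      f f⁻¹ : Point → Point
      f   (x , y) = c * (x - a) - δ * s * (y - b) + a′ , s * (x - a) + δ * c * (y - b) + b′
      -- The inverse of an orthogonal matrix is its transpose.
      f⁻¹ (x , y) = c * (x - a′) + s * (y - b′) + a , δ * (c * (y - b′) - s * (x - a′)) + b

      f-cong : ∀ {P Q} → P ≈ₚ Q → f P ≈ₚ f Q
      f-cong (p , q) =
        +-congʳ (+-cong (*-congˡ (+-congʳ p)) (-‿cong (*-congˡ (+-congʳ q)))) ,
        +-congʳ (+-cong (*-congˡ (+-congʳ p)) (*-congˡ (+-congʳ q)))

      f⁻¹-cong : ∀ {P Q} → P ≈ₚ Q → f⁻¹ P ≈ₚ f⁻¹ Q
      f⁻¹-cong (p , q) =
        +-congʳ (+-cong (*-congˡ (+-congʳ p)) (*-congˡ (+-congʳ q))) ,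
        +-congʳ (*-congˡ (+-cong (*-congˡ (+-congʳ q)) (-‿cong (*-congˡ (+-congʳ p)))))

      ff⁻¹ : ∀ P → f (f⁻¹ P) ≈ₚ P
      ff⁻¹ (x , y) =
        modulo₂ unit sign (solve 9 (λ c s δ a b a′ b′ x y →
          c :* ((c :* (x :- a′) :+ s :* (y :- b′) :+ a) :- a) :-
          δ :* s :* ((δ :* (c :* (y :- b′) :- s :* (x :- a′)) :+ b) :- b) :+ a′ :=
          x :+ (x :- a′) :* (c :* c :+ s :* s :- :# 1)
            :+ (s :* s :* (x :- a′) :- c :* s :* (y :- b′)) :* (δ :* δ :- :# 1))
          refl c s δ a b a′ b′ x y) ,
        modulo₂ unit sign (solve 9 (λ c s δ a b a′ b′ x y →
          s :* ((c :* (x :- a′) :+ s :* (y :- b′) :+ a) :- a) :+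
          δ :* c :* ((δ :* (c :* (y :- b′) :- s :* (x :- a′)) :+ b) :- b) :+ b′ :=
          y :+ (y :- b′) :* (c :* c :+ s :* s :- :# 1)
            :+ (c :* c :* (y :- b′) :- s :* c :* (x :- a′)) :* (δ :* δ :- :# 1))
          refl c s δ a b a′ b′ x y)

      f⁻¹f : ∀ P → f⁻¹ (f P) ≈ₚ P
      f⁻¹f (x , y) =
        x≈y+k[l-r]⇒x≈y unit (solve 9 (λ c s δ a b a′ b′ x y →
          c :* ((c :* (x :- a) :- δ :* s :* (y :- b) :+ a′) :- a′) :+
          s :* ((s :* (x :- a) :+ δ :* c :* (y :- b) :+ b′) :- b′) :+ a :=
          x :+ (x :- a) :* (c :* c :+ s :* s :- :# 1))
          refl c s δ a b a′ b′ x y) ,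
        modulo₂ unit sign (solve 9 (λ c s δ a b a′ b′ x y →
          δ :* (c :* ((s :* (x :- a) :+ δ :* c :* (y :- b) :+ b′) :- b′) :-
                s :* ((c :* (x :- a) :- δ :* s :* (y :- b) :+ a′) :- a′)) :+ b :=
          y :+ (δ :* δ :* (y :- b)) :* (c :* c :+ s :* s :- :# 1)
            :+ (y :- b) :* (δ :* δ :- :# 1))
          refl c s δ a b a′ b′ x y)

      f-sq : ∀ P Q → sq (f P) (f Q) ≈ sq P Q
      f-sq (x , y) (x′ , y′) = modulo₂ unit sign (trans
        (+-cong (*-cong p p) (*-cong q q))
        (solve 5 (λ c s δ x y →
          (c :* x :- δ :* s :* y) :* (c :* x :- δ :* s :* y) :+
          (s :* x :+ δ :* c :* y) :* (s :* x :+ δ :* c :* y) :=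
          x :* x :+ y :* y
            :+ (x :* x :+ δ :* δ :* (y :* y)) :* (c :* c :+ s :* s :- :# 1)
            :+ y :* y :* (δ :* δ :- :# 1))
          refl c s δ (x - x′) (y - y′)))
        where
        p = solve 9 (λ c t a b e x y x′ y′ →
              (c :* (x :- a) :- t :* (y :- b) :+ e) :- (c :* (x′ :- a) :- t :* (y′ :- b) :+ e) :=
              c :* (x :- x′) :- t :* (y :- y′)) refl c (δ * s) a b a′ x y x′ y′
        q = solve 9 (λ s t a b e x y x′ y′ →
              (s :* (x :- a) :+ t :* (y :- b) :+ e) :- (s :* (x′ :- a) :+ t :* (y′ :- b) :+ e) :=
              s :* (x :- x′) :+ t :* (y :- y′)) refl s (δ * c) a b b′ x y x′ y′

    motion : Isometry
    motion = record
      { bijection = record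
        { to        = f
        ; from      = f⁻¹
        ; to-cong   = f-cong
        ; from-cong = f⁻¹-cong
        ; inverse   =
            (λ {x} p → ≈ₚ-trans (f-cong p) (ff⁻¹ x)) ,
            (λ {x} p → ≈ₚ-trans (f⁻¹-cong p) (f⁻¹f x))
        }
      ; isometric = λ P Q → √-cong (f-sq P Q)
      }

  module _ {A B A′ B′ : Point} (eq : sq A B ≈ sq A′ B′) (sq≉0 : ¬ (sq A B ≈ 0#)) where
    private
      p q p′ q′ n i c s : ℝ
      p  = proj₁ B - proj₁ A
      q  = proj₂ B - proj₂ A
      p′ = proj₁ B′ - proj₁ A′
      q′ = proj₂ B′ - proj₂ A′
      n  = sq A B
      i  = n ⁻¹
      -- In complex notation `c + s i` is the quotient (B′ - A′)/(B - A), which has modulus 1.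
      c  = (p * p′ + q * q′) * i
      s  = (p * q′ - q * p′) * i

      ni≈1 : n * i ≈ 1#
      ni≈1 = ⁻¹-inverseʳ n sq≉0

      sq-flip : ∀ x y x′ y′ → (x - x′) * (x - x′) + (y - y′) * (y - y′) ≈
                              (x′ - x) * (x′ - x) + (y′ - y) * (y′ - y)
      sq-flip = solve 4 (λ x y x′ y′ →
        (x :- x′) :* (x :- x′) :+ (y :- y′) :* (y :- y′) :=
        (x′ :- x) :* (x′ :- x) :+ (y′ :- y) :* (y′ :- y)) refl

      n≈ : n ≈ p * p + q * q
      n≈ = sq-flip _ _ _ _

      n≈′ : n ≈ p′ * p′ + q′ * q′
      n≈′ = trans eq (sq-flip _ _ _ _)

      unit : c * c + s * s ≈ 1#
      unit = trans
        (solve 5 (λ p q p′ q′ i →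
          ((p :* p′ :+ q :* q′) :* i) :* ((p :* p′ :+ q :* q′) :* i) :+
          ((p :* q′ :- q :* p′) :* i) :* ((p :* q′ :- q :* p′) :* i) :=
          ((p :* p :+ q :* q) :* i) :* ((p′ :* p′ :+ q′ :* q′) :* i)) refl p q p′ q′ i)
        (trans (*-cong (trans (*-congʳ (sym n≈)) ni≈1) (trans (*-congʳ (sym n≈′)) ni≈1))
               (*-identityˡ 1#))

      [p²+q²]i≈1 : (p * p + q * q) * i ≈ 1#
      [p²+q²]i≈1 = trans (*-congʳ (sym n≈)) ni≈1

    transport : Isometry
    transport = motion unit (*-identityˡ 1#) A A′

    transport-A : Isometry.to transport A ≈ₚ A′
    transport-A =
      solve 5 (λ c s a b e → c :* (a :- a) :- :# 1 :* s :* (b :- b) :+ e := e) refl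
        c s (proj₁ A) (proj₂ A) (proj₁ A′) ,
      solve 5 (λ c s a b e → s :* (a :- a) :+ :# 1 :* c :* (b :- b) :+ e := e) refl
        c s (proj₁ A) (proj₂ A) (proj₂ A′)

    transport-B : Isometry.to transport B ≈ₚ B′
    transport-B =
      x≈y+k[l-r]⇒x≈y [p²+q²]i≈1 (solve 6 (λ p q x y e i → let p′ = x :- e in
        ((p :* p′ :+ q :* y) :* i) :* p :- :# 1 :* ((p :* y :- q :* p′) :* i) :* q :+ e :=
        x :+ p′ :* ((p :* p :+ q :* q) :* i :- :# 1)) refl
        p q (proj₁ B′) q′ (proj₁ A′) i) ,
      x≈y+k[l-r]⇒x≈y [p²+q²]i≈1 (solve 6 (λ p q x y e i → let q′ = y :- e in
        ((p :* q′ :- q :* x) :* i) :* p :+ :# 1 :* ((p :* x :+ q :* q′) :* i) :* q :+ e :=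
        y :+ q′ :* ((p :* p :+ q :* q) :* i :- :# 1)) refl
        p q p′ (proj₂ B′) (proj₂ A′) i)

-- Colour patterns on finitely many points.

-- (k , i , js) stands for k times the indicator of "every point of js has the
-- colour of the point i".
Pattern : ℕ → Set
Pattern n = ℕ × Fin n × List (Fin n)

module _ {n : ℕ} where
  monochromatic? : (v : Vec (Fin 4) n) (i : Fin n) (js : List (Fin n)) →
                   Dec (All (λ j → lookup v i ≡ lookup v j) js)
  monochromatic? v i js = All.all? (λ j → lookup v i Fin.≟ lookup v j) js

  total : List (Pattern n) → Vec (Fin 4) n → ℕ
  total []                  v = 0
  total ((k , i , js) ∷ ps) v = (if does (monochromatic? v i js) then k else 0) ℕ.+ total ps v

all-Vec? : ∀ {k} n {P : Vec (Fin k) n → Set} → (∀ v → Dec (P v)) → Dec (∀ v → P v)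
all-Vec? zero    P? = map′ (λ { p [] → p }) (λ f → f []) (P? [])
all-Vec? (suc n) P? = map′ (λ { f (x ∷ v) → f x v }) (λ f x v → f (x ∷ v))
  (Fin.all? λ x → all-Vec? n λ v → P? (x ∷ v))

-- Runs through all 4ⁿ colour vectors; on concrete lists `from-yes` turns the outcome into a proof
-- by computation.
_≼?_ : ∀ {n} (ps qs : List (Pattern n)) → Dec (∀ v → total ps v ℕ.≤ total qs v)
_≼?_ {n} ps qs = all-Vec? n λ v → total ps v ℕ.≤? total qs v

-- Probabilities of monochromatic configurations.

module Monochromaticity (F : CompleteOrderedField) (c₀ : Plane.ProperColouring F)
  (m : Plane.LeftInvariantProbability F) where
  open Reals F hiding (total)
  open Motions F public
  open ProperColouring c₀
  open FiniteAdditivity F S₄×E₂ m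
  open Measure F S₄×E₂ using (pred)
  open LeftInvariantProbability m using (μ; cong)
    renaming (total to μ-whole)
  private module G = Group S₄×E₂

  col : G.Carrier → Point → Fin 4
  col = randomColouring c₀

  col-cong : ∀ g {A B} → A ≈ₚ B → col g A ≡ col g B
  col-cong (σ , T) A≈B = ≡.cong (σ ⟨$⟩ʳ_) (colour-cong (Isometry.from-cong T A≈B))

  Same : Point → List Point → Event
  Same A Bs = record
    { set  = mkSubset (λ g → All (λ B → col g A ≡ col g B) Bs)
        λ {g} {h} g≈h → All.map λ {B} eq →
          ≡.trans (≡.sym (col≈ g h g≈h A)) (≡.trans eq (col≈ g h g≈h B))
    ; _∈?_ = λ g → All.all? (λ B → col g A Fin.≟ col g B) Bs
    }
    where
    col≈ : ∀ g h → g G.≈ h → ∀ C → col g C ≡ col h C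
    col≈ (σ , S) (τ , T) (σ≈τ , S≈T) C =
      ≡.trans (≡.cong (σ ⟨$⟩ʳ_) (colour-cong (from-unique {S} {T} S≈T C))) (σ≈τ _)

  pr : Point → List Point → ℝ
  pr A Bs = μ (set (Same A Bs))

  pr≈probMono : ∀ A B → pr A [ B ] ≈ probMono c₀ m A B
  pr≈probMono A B = cong _ _ ((λ { (eq ∷ []) → eq }) , (λ eq → eq ∷ []))

  pr[]≈1 : ∀ A → pr A [] ≈ 1#
  pr[]≈1 A = trans (cong _ _ ((λ _ → tt) , (λ _ → []))) μ-whole

  -- The inverse of `T` preserves the unit distance and `σ` is injective, so properness of `c₀`
  -- makes the event empty.
  sq≈1⇒pr≈0 : ∀ A B → sq A B ≈ 1# → pr A [ B ] ≈ 0#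
  sq≈1⇒pr≈0 A B sq≈1 = μ-empty _ λ { (σ , T) (eq ∷ []) →
    proper (trans (Isometry.isometric (Group._⁻¹ E₂ T) A B) dist≈1)
      (Injection.injective (↔⇒↣ σ) eq) }
    where
    1*1≈d*d : 1# * 1# ≈ dist A B * dist A B
    1*1≈d*d = trans (*-identityˡ 1#) (sym (trans (dist²≈sq A B) sq≈1))
    dist≈1 : dist A B ≈ 1#
    dist≈1 = antisym (²-cancel-≤ 0≤1 (≤-reflexive (sym 1*1≈d*d)))
                     (²-cancel-≤ (√-nonNeg _) (≤-reflexive 1*1≈d*d))

  -- With `g = (id , R)`, the colouring given by `g⁻¹ ∙ h` has at `B` the colour that the one given
  -- by `h` has at `R B`. The two events are therefore translates of each other by `g`.
  pr-move : (R : Isometry) → ∀ {A A′ Bs Bs′} → Isometry.to R A ≈ₚ A′ →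
            Pointwise (λ B B′ → Isometry.to R B ≈ₚ B′) Bs Bs′ → pr A Bs ≈ pr A′ Bs′
  pr-move R {A} {A′} {Bs} {Bs′} A↦A′ Bs↦Bs′ =
    sym (μ-shift g (Subset-of A Bs) (Subset-of A′ Bs′) (λ h → forward h Bs↦Bs′) (λ h → backward h Bs↦Bs′))
    where
    g : G.Carrier
    g = Perm.id , R
    Subset-of : Point → List Point → Measure.Subset F S₄×E₂
    Subset-of A Bs = set (Same A Bs)
    moved : ∀ h {B B′} → Isometry.to R B ≈ₚ B′ → col (g G.⁻¹ G.∙ h) B ≡ col h B′
    moved h B↦B′ = col-cong h B↦B′
    forward : ∀ h {Bs Bs′} → Pointwise (λ B B′ → Isometry.to R B ≈ₚ B′) Bs Bs′ →
      All (λ B → col h A′ ≡ col h B) Bs′ → All (λ B → col (g G.⁻¹ G.∙ h) A ≡ col (g G.⁻¹ G.∙ h) B) Bs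
    forward h []       []         = []
    forward h (p ∷ ps) (eq ∷ eqs) =
      ≡.trans (moved h A↦A′) (≡.trans eq (≡.sym (moved h p))) ∷ forward h ps eqs
    backward : ∀ h {Bs Bs′} → Pointwise (λ B B′ → Isometry.to R B ≈ₚ B′) Bs Bs′ →
      All (λ B → col (g G.⁻¹ G.∙ h) A ≡ col (g G.⁻¹ G.∙ h) B) Bs → All (λ B → col h A′ ≡ col h B) Bs′
    backward h []       []         = []
    backward h (p ∷ ps) (eq ∷ eqs) =
      ≡.trans (≡.sym (moved h A↦A′)) (≡.trans eq (moved h p)) ∷ backward h ps eqs

  pr-pair-cong : ∀ {A B A′ B′} → sq A B ≈ sq A′ B′ → ¬ (sq A B ≈ 0#) → pr A [ B ] ≈ pr A′ [ B′ ]
  pr-pair-cong eq sq≉0 = pr-move (transport eq sq≉0) (transport-A eq sq≉0) (transport-B eq sq≉0 ∷ [])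

  private
    expectation : ∀ {n} → Vec Point n → List (Pattern n) → ℝ
    expectation V []                  = 0#
    expectation V ((k , i , js) ∷ ps) =
      fromℕ k * pr (lookup V i) (List.map (lookup V) js) + expectation V ps

    events : ∀ {n} → Vec Point n → List (Pattern n) → List (ℕ × Event)
    events V = List.map λ (k , i , js) → k , Same (lookup V i) (List.map (lookup V) js)

    expected-events : ∀ {n} (V : Vec Point n) ps → expected (events V ps) ≈ expectation V ps
    expected-events V []       = refl
    expected-events V (_ ∷ ps) = +-congˡ (expected-events V ps)

    does-same : ∀ {n} (V : Vec Point n) g i js →
      does (All.all? (λ B → col g (lookup V i) Fin.≟ col g B) (List.map (lookup V) js)) ≡
      does (monochromatic? (Vec.map (col g) V) i js)
    does-same V g i [] = ≡.refl
    does-same V g i (j ∷ js) = ≡.cong₂ _∧_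
      (≡.sym (≡.cong₂ (λ a b → does (a Fin.≟ b)) (lookup-map i (col g) V) (lookup-map j (col g) V)))
      (does-same V g i js)

    count-events : ∀ {n} (V : Vec Point n) ps g →
      count (events V ps) g ≡ total ps (Vec.map (col g) V)
    count-events V []                  g = ≡.refl
    count-events V ((k , i , js) ∷ ps) g =
      ≡.cong₂ (λ b t → (if b then k else 0) ℕ.+ t) (does-same V g i js) (count-events V ps g)

    expectation-mono : ∀ {n} (V : Vec Point n) ps qs → (∀ v → total ps v ℕ.≤ total qs v) →
                       expectation V ps ≤ expectation V qs
    expectation-mono V ps qs h = ≤-resp (expected-events V ps) (expected-events V qs)
      (expected-mono (events V ps) (events V qs) λ g →
        ≡.subst₂ ℕ._≤_ (≡.sym (count-events V ps g)) (≡.sym (count-events V qs g))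
          (h (Vec.map (col g) V)))

  Values : ∀ {n} → Vec Point n → List (Pattern n) → List ℝ → Set
  Values V = Pointwise λ (_ , i , js) x → pr (lookup V i) (List.map (lookup V) js) ≈ x

  -- Multiples are taken with ⟦ + k ⟧ so that the sums are polynomials as the
  -- ring solver writes them.
  weighted : ∀ {n} → List (Pattern n) → List ℝ → ℝ
  weighted ((k , _) ∷ ps) (x ∷ xs) = ⟦ + k ⟧ * x + weighted ps xs
  weighted _              _        = 0#

  -- A group element enters only through the colours it gives to `V`, so an inequality valid for all
  -- colour vectors can be averaged. The values `xs` and `ys` are passed separately so that
  -- congruent configurations can share one variable.
  weighted-mono : ∀ {n} (V : Vec Point n) ps qs xs ys → (∀ v → total ps v ℕ.≤ total qs v) →
                  Values V ps xs → Values V qs ys → weighted ps xs ≤ weighted qs ys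
  weighted-mono V ps qs xs ys h pv qv = ≤-resp (evaluate pv) (evaluate qv) (expectation-mono V ps qs h)
    where
    evaluate : ∀ {ps xs} → Values V ps xs → expectation V ps ≈ weighted ps xs
    evaluate []       = refl
    evaluate {(k , _) ∷ _} (p ∷ ps) = +-cong (*-cong (sym (⟦+⟧ k)) p) (evaluate ps)

-- Pattern inequalities verified over all colour vectors.

infix 6 _·⟨_∣_⟩
_·⟨_∣_⟩ : ∀ {n} → ℕ → Fin n → List (Fin n) → Pattern n
k ·⟨ i ∣ js ⟩ = k , i , js

-- 1, 2, 3, 4 are consecutive vertices of a regular hexagon with centre 0.  The
-- coefficients are a dual solution of a linear program.
trapezoidˡ trapezoidʳ : List (Pattern 5)
trapezoidˡ =
  1 ·⟨ # 0 ∣ [] ⟩ ∷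
  5 ·⟨ # 0 ∣ # 1 ∷ # 2 ∷ [] ⟩ ∷
  5 ·⟨ # 0 ∣ # 2 ∷ # 3 ∷ [] ⟩ ∷
  3 ·⟨ # 0 ∣ # 3 ∷ # 4 ∷ [] ⟩ ∷
  3 ·⟨ # 0 ∣ # 1 ∷ # 3 ∷ [] ⟩ ∷
  2 ·⟨ # 2 ∣ # 3 ∷ # 1 ∷ [] ⟩ ∷
  2 ·⟨ # 3 ∣ # 4 ∷ # 2 ∷ [] ⟩ ∷
  6 ·⟨ # 0 ∣ # 2 ∷ # 3 ∷ # 4 ∷ [] ⟩ ∷ []
trapezoidʳ =
  1 ·⟨ # 0 ∣ [ # 1 ] ⟩ ∷
  4 ·⟨ # 0 ∣ [ # 2 ] ⟩ ∷
  2 ·⟨ # 0 ∣ [ # 3 ] ⟩ ∷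
  1 ·⟨ # 0 ∣ [ # 4 ] ⟩ ∷
  1 ·⟨ # 1 ∣ [ # 2 ] ⟩ ∷
  1 ·⟨ # 2 ∣ [ # 3 ] ⟩ ∷
  1 ·⟨ # 3 ∣ [ # 4 ] ⟩ ∷
  1 ·⟨ # 1 ∣ [ # 3 ] ⟩ ∷
  1 ·⟨ # 2 ∣ [ # 4 ] ⟩ ∷
  1 ·⟨ # 1 ∣ [ # 4 ] ⟩ ∷
  7 ·⟨ # 0 ∣ # 2 ∷ # 4 ∷ [] ⟩ ∷
  6 ·⟨ # 0 ∣ # 1 ∷ # 2 ∷ # 3 ∷ [] ⟩ ∷ []

trapezoid : ∀ v → total trapezoidˡ v ℕ.≤ total trapezoidʳ v
trapezoid = from-yes (trapezoidˡ ≼? trapezoidʳ)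

pairˡ pairʳ : List (Pattern 2)
pairˡ = 1 ·⟨ # 0 ∣ [ # 1 ] ⟩ ∷ []
pairʳ = 1 ·⟨ # 0 ∣ [] ⟩ ∷ []

pair : ∀ v → total pairˡ v ℕ.≤ total pairʳ v
pair = from-yes (pairˡ ≼? pairʳ)

-- 1, 3, 4 form a unit triangle: the last three terms on the right vanish in
-- expectation, as does the last one of unitEdgeʳ.
apexˡ apexʳ : List (Pattern 5)
apexˡ =
  1 ·⟨ # 0 ∣ [ # 1 ] ⟩ ∷
  1 ·⟨ # 0 ∣ [ # 2 ] ⟩ ∷
  1 ·⟨ # 0 ∣ [ # 3 ] ⟩ ∷
  1 ·⟨ # 0 ∣ [ # 4 ] ⟩ ∷ []
apexʳ =
  1 ·⟨ # 0 ∣ [] ⟩ ∷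
  1 ·⟨ # 0 ∣ # 1 ∷ # 2 ∷ [] ⟩ ∷
  1 ·⟨ # 0 ∣ # 2 ∷ # 3 ∷ [] ⟩ ∷
  1 ·⟨ # 0 ∣ # 2 ∷ # 4 ∷ [] ⟩ ∷
  1 ·⟨ # 1 ∣ [ # 3 ] ⟩ ∷
  1 ·⟨ # 1 ∣ [ # 4 ] ⟩ ∷
  1 ·⟨ # 3 ∣ [ # 4 ] ⟩ ∷ []

-- If at most one of 1, 3, 4 has the colour of 0, the left side exceeds 1 only when that point and 2
-- both have it, and the right side counts this triple. Otherwise monochromatic pairs of the
-- triangle make up the difference.
apex : ∀ v → total apexˡ v ℕ.≤ total apexʳ v
apex = from-yes (apexˡ ≼? apexʳ)

unitEdgeˡ unitEdgeʳ : List (Pattern 4)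
unitEdgeˡ =
  1 ·⟨ # 1 ∣ # 0 ∷ # 2 ∷ [] ⟩ ∷
  1 ·⟨ # 0 ∣ # 3 ∷ # 2 ∷ [] ⟩ ∷ []
unitEdgeʳ =
  1 ·⟨ # 0 ∣ [ # 2 ] ⟩ ∷
  1 ·⟨ # 1 ∣ [ # 3 ] ⟩ ∷ []

-- Each event on the left makes 0 and 2 agree; both together also make 1 and 3 agree.
unitEdge : ∀ v → total unitEdgeˡ v ℕ.≤ total unitEdgeʳ v
unitEdge = from-yes (unitEdgeˡ ≼? unitEdgeʳ)

-- The right side lists all ten pairs of five points, of which four colours leave at least one
-- monochromatic. The order anticipates the geometry: three unit pairs, five pairs at distance d,
-- then the remaining two.
pigeonholeˡ pigeonholeʳ : List (Pattern 5)
pigeonholeˡ = 1 ·⟨ # 0 ∣ [] ⟩ ∷ []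
pigeonholeʳ =
  1 ·⟨ # 0 ∣ [ # 1 ] ⟩ ∷
  1 ·⟨ # 0 ∣ [ # 2 ] ⟩ ∷
  1 ·⟨ # 1 ∣ [ # 2 ] ⟩ ∷
  1 ·⟨ # 3 ∣ [ # 1 ] ⟩ ∷
  1 ·⟨ # 3 ∣ [ # 2 ] ⟩ ∷
  1 ·⟨ # 4 ∣ [ # 0 ] ⟩ ∷
  1 ·⟨ # 4 ∣ [ # 1 ] ⟩ ∷
  1 ·⟨ # 3 ∣ [ # 4 ] ⟩ ∷
  1 ·⟨ # 3 ∣ [ # 0 ] ⟩ ∷
  1 ·⟨ # 4 ∣ [ # 2 ] ⟩ ∷ []

pigeonhole : ∀ v → total pigeonholeˡ v ℕ.≤ total pigeonholeʳ v
pigeonhole = from-yes (pigeonholeˡ ≼? pigeonholeʳ)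

-- Rotation by 60° in coordinates.

module Coordinates (F : CompleteOrderedField) where
  open Reals F
  open Motions F

  s : ℝ
  s = ½ * √3

  ½²+s²≈1 : ½ * ½ + s * s ≈ 1#
  ½²+s²≈1 = x≈y+k[l-r]⇒x≈y {k = ½ * ½} √3*√3≈3
    (trans (solve 2 (λ c r → c :* c :+ (c :* r) :* (c :* r) :=
             (c :+ c) :* (c :+ c) :+ c :* c :* (r :* r :- :# 3)) refl ½ √3)
           (+-congʳ (trans (*-cong ½+½≈1 ½+½≈1) (*-identityˡ 1#))))

  -- Identities modulo ½ + ½ ≈ 1 and ½² + s² ≈ 1, with k and k′ the cofactors.
  mod : ∀ {x y} k k′ → x ≈ y + k * (½ + ½ - 1#) + k′ * (½ * ½ + s * s - 1#) → x ≈ y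
  mod k k′ eq = x≈y+k[l-r]⇒x≈y ½+½≈1 (x≈y+k[l-r]⇒x≈y ½²+s²≈1 eq)

  ¼≤x⇒x≉0 : ∀ {x} → ¼≤ x → ¬ (x ≈ 0#)
  ¼≤x⇒x≉0 {x} p x≈0 = 0≉1 (antisym 0≤1 (≤-resp four zero′ (*-monoˡ-≤ (fromℕ 4) (0≤fromℕ 4) p)))
    where
    four : fromℕ 4 * (½ * ½) ≈ 1#
    four = trans (solve 1 (λ c → :# 4 :* (c :* c) := (c :+ c) :* (c :+ c)) refl ½)
                 (trans (*-cong ½+½≈1 ½+½≈1) (*-identityˡ 1#))
    zero′ : fromℕ 4 * x ≈ 0#
    zero′ = trans (*-congˡ x≈0) (zeroʳ (fromℕ 4))

  o : Point
  o = 0# , 0#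

  -- Multiplication by the complex number ½ + s i = e^{iπ/3}.
  ω_ : Point → Point
  ω (x , y) = ½ * x - s * y , s * x + ½ * y

  infixl 6 _⊕_ _⊖_
  _⊕_ _⊖_ : Point → Point → Point
  (x , y) ⊕ (x′ , y′) = x + x′ , y + y′
  (x , y) ⊖ (x′ , y′) = x - x′ , y - y′

  ⊕-cong : ∀ {P P′ Q Q′} → P ≈ₚ P′ → Q ≈ₚ Q′ → P ⊕ Q ≈ₚ P′ ⊕ Q′
  ⊕-cong (p , q) (p′ , q′) = +-cong p p′ , +-cong q q′

  -- A primitive sixth root of unity is a root of z² - z + 1.
  ω²≈ω-1 : ∀ P → ω (ω P) ≈ₚ ω P ⊖ P
  ω²≈ω-1 (x , y) =
    mod (½ * x - s * y) (- x) (solve 4 (λ c s x y →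
      c :* (c :* x :- s :* y) :- s :* (s :* x :+ c :* y) :=
      (c :* x :- s :* y :- x) :+ (c :* x :- s :* y) :* (c :+ c :- :# 1)
        :+ (:- x) :* (c :* c :+ s :* s :- :# 1))
      refl ½ s x y) ,
    mod (s * x + ½ * y) (- y) (solve 4 (λ c s x y →
      s :* (c :* x :- s :* y) :+ c :* (s :* x :+ c :* y) :=
      (s :* x :+ c :* y :- y) :+ (s :* x :+ c :* y) :* (c :+ c :- :# 1)
        :+ (:- y) :* (c :* c :+ s :* s :- :# 1))
      refl ½ s x y)

  ω[ω-1]≈-1 : ∀ P → ω (ω P ⊖ P) ≈ₚ o ⊖ P
  ω[ω-1]≈-1 (x , y) =
    mod (½ * x - s * y) (- x) (solve 4 (λ c s x y →
      c :* (c :* x :- s :* y :- x) :- s :* (s :* x :+ c :* y :- y) :=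
      (:# 0 :- x) :+ (c :* x :- s :* y) :* (c :+ c :- :# 1) :+ (:- x) :* (c :* c :+ s :* s :- :# 1))
      refl ½ s x y) ,
    mod (s * x + ½ * y) (- y) (solve 4 (λ c s x y →
      s :* (c :* x :- s :* y :- x) :+ c :* (s :* x :+ c :* y :- y) :=
      (:# 0 :- y) :+ (s :* x :+ c :* y) :* (c :+ c :- :# 1) :+ (:- y) :* (c :* c :+ s :* s :- :# 1))
      refl ½ s x y)

  rotate : Point → Isometry
  rotate A = motion ½²+s²≈1 (*-identityˡ 1#) o A

  rotate≈ : ∀ A P → Isometry.to (rotate A) P ≈ₚ ω P ⊕ A
  rotate≈ (a , b) (x , y) =
    solve 5 (λ c s a x y → c :* (x :- :# 0) :- :# 1 :* s :* (y :- :# 0) :+ a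
      := c :* x :- s :* y :+ a)
      refl ½ s a x y ,
    solve 5 (λ c s b x y → s :* (x :- :# 0) :+ :# 1 :* c :* (y :- :# 0) :+ b
      := s :* x :+ c :* y :+ b)
      refl ½ s b x y

-- The hexagon configuration and the inequality 28 p ≤ 12 + 2 ρ + σ.

module Hexagon (F : CompleteOrderedField) (c₀ : Plane.ProperColouring F)
  (m : Plane.LeftInvariantProbability F) (n : CompleteOrderedField.ℝ F)
  (¼≤n : Reals.¼≤_ F n) where
  open Reals F hiding (total)
  open Coordinates F
  open Monochromaticity F c₀ m

  -- The abscissa that puts (a, ±½) at squared distance `n` from the origin; these two points are 1
  -- apart.
  a : ℝ
  a = √ (n - ½ * ½)

  a²≈n-½² : a * a ≈ n - ½ * ½
  a²≈n-½² = √-square (x≤y⇒0≤y-x ¼≤n)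

  a²+½²≈n : a * a + ½ * ½ ≈ n
  a²+½²≈n = trans (+-congʳ a²≈n-½²) (x-y+y n (½ * ½))

  -- u₀, h₁, h₂, h₃ are consecutive vertices of a regular hexagon with centre o.
  u₀ u₁ h₁ h₂ h₃ t₁ T : Point
  u₀ = a , - ½
  u₁ = a , ½
  h₁ = ω u₀
  h₂ = ω u₀ ⊖ u₀
  h₃ = o ⊖ u₀
  t₁ = ω u₁
  T  = ω u₁ ⊖ u₁ ⊕ u₀

  P⊕o : ∀ P → P ⊕ o ≈ₚ P
  P⊕o (x , y) = +-identityʳ x , +-identityʳ y

  rot : Isometry
  rot = rotate o

  rot-to : ∀ {P Q} → ω P ≈ₚ Q → Isometry.to rot P ≈ₚ Q
  rot-to {P} eq = ≈ₚ-trans (rotate≈ o P) (≈ₚ-trans (P⊕o (ω P)) eq)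

  ωo≈o : ω o ≈ₚ o
  ωo≈o = solve 2 (λ c s → c :* :# 0 :- s :* :# 0 := :# 0) refl ½ s ,
         solve 2 (λ c s → s :* :# 0 :+ c :* :# 0 := :# 0) refl ½ s

  rot-o : Isometry.to rot o ≈ₚ o
  rot-o = rot-to ωo≈o
  rot-u₀ : Isometry.to rot u₀ ≈ₚ h₁
  rot-u₀ = rot-to ≈ₚ-refl
  rot-h₁ : Isometry.to rot h₁ ≈ₚ h₂
  rot-h₁ = rot-to (ω²≈ω-1 u₀)
  rot-h₂ : Isometry.to rot h₂ ≈ₚ h₃
  rot-h₂ = rot-to (ω[ω-1]≈-1 u₀)
  rot-u₁ : Isometry.to rot u₁ ≈ₚ t₁
  rot-u₁ = rot-to ≈ₚ-refl

  -- The map z ↦ ω z + u₀ is the rotation by 60° about `h₁`, because ω² + 1 = ω. It takes `h₂` to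
  -- `o`, `o` to `u₀`, and `t₁` to `T`, the third vertex of a unit triangle on `h₁`, `t₁`.
  rot′ : Isometry
  rot′ = rotate u₀

  rot′-to : ∀ {P Q R} → ω P ≈ₚ Q → Q ⊕ u₀ ≈ₚ R → Isometry.to rot′ P ≈ₚ R
  rot′-to {P} p q = ≈ₚ-trans (rotate≈ u₀ P) (≈ₚ-trans (⊕-cong p ≈ₚ-refl) q)

  rot′-o : Isometry.to rot′ o ≈ₚ u₀
  rot′-o = rot′-to ωo≈o (+-identityˡ _ , +-identityˡ _)
  rot′-h₁ : Isometry.to rot′ h₁ ≈ₚ h₁
  rot′-h₁ = rot′-to (ω²≈ω-1 u₀) (x-y+y _ _ , x-y+y _ _)
  rot′-h₂ : Isometry.to rot′ h₂ ≈ₚ o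
  rot′-h₂ = rot′-to (ω[ω-1]≈-1 u₀) (x-y+y _ _ , x-y+y _ _)
  rot′-t₁ : Isometry.to rot′ t₁ ≈ₚ T
  rot′-t₁ = rot′-to (ω²≈ω-1 u₁) ≈ₚ-refl

  -- The map z ↦ h₁ - z, a half turn about the centre of the rhombus `o`, `u₀`, `h₁`, `h₂`.
  halfTurn : Isometry
  halfTurn = motion {c = - 1#} {s = 0#}
    (solve 0 ((:- :# 1) :* (:- :# 1) :+ :# 0 :* :# 0 := :# 1) refl) (*-identityˡ 1#) o h₁

  halfTurn-to : ∀ {P Q} → h₁ ⊖ P ≈ₚ Q → Isometry.to halfTurn P ≈ₚ Q
  halfTurn-to {x , y} eq = ≈ₚ-trans
    (solve 3 (λ x y e → (:- :# 1) :* (x :- :# 0) :- :# 1 :* :# 0 :* (y :- :# 0) :+ e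
      := e :- x) refl x y _ ,
     solve 3 (λ x y e → :# 0 :* (x :- :# 0) :+ :# 1 :* (:- :# 1) :* (y :- :# 0) :+ e
       := e :- y) refl x y _) eq

  halfTurn-o : Isometry.to halfTurn o ≈ₚ h₁
  halfTurn-o = halfTurn-to (x-0 _ , x-0 _)
    where
    x-0 : ∀ x → x - 0# ≈ x
    x-0 = solve 1 (λ x → x :- :# 0 := x) refl
  halfTurn-u₀ : Isometry.to halfTurn u₀ ≈ₚ h₂
  halfTurn-u₀ = halfTurn-to ≈ₚ-refl
  halfTurn-h₂ : Isometry.to halfTurn h₂ ≈ₚ u₀
  halfTurn-h₂ = halfTurn-to (x-[x-y] _ _ , x-[x-y] _ _)
    where
    x-[x-y] : ∀ x y → x - (x - y) ≈ y
    x-[x-y] = solve 2 (λ x y → x :- (x :- y) := y) refl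

  -- z ↦ ω² z̄, the reflection in the line through o and T.
  reflect : Isometry
  reflect = motion {c = - ½} {s = s} {δ = - 1#}
    (trans (+-congʳ (solve 1 (λ c → (:- c) :* (:- c) := c :* c) refl ½)) ½²+s²≈1)
    (solve 0 ((:- :# 1) :* (:- :# 1) := :# 1) refl) o o

  reflect-to : ∀ {x y Q} → (s * y - ½ * x , s * x + ½ * y) ≈ₚ Q → Isometry.to reflect (x , y) ≈ₚ Q
  reflect-to {x} {y} eq = ≈ₚ-trans
    (solve 4 (λ c s x y → (:- c) :* (x :- :# 0) :- (:- :# 1) :* s :* (y :- :# 0) :+ :# 0
      := s :* y :- c :* x) refl ½ s x y ,
     solve 4 (λ c s x y → s :* (x :- :# 0) :+ (:- :# 1) :* (:- c) :* (y :- :# 0) :+ :# 0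
       := s :* x :+ c :* y) refl ½ s x y) eq

  reflect-o : Isometry.to reflect o ≈ₚ o
  reflect-o = reflect-to
    (solve 2 (λ c s → s :* :# 0 :- c :* :# 0 := :# 0) refl ½ s ,
     solve 2 (λ c s → s :* :# 0 :+ c :* :# 0 := :# 0) refl ½ s)
  reflect-h₂ : Isometry.to reflect h₂ ≈ₚ u₁
  reflect-h₂ = reflect-to
    (mod (- (a * ½ + s * ½)) a (solve 3 (λ c s a →
       let x = c :* a :- s :* (:- c) :- a
           y = s :* a :+ c :* (:- c) :- (:- c) in
       s :* y :- c :* x := a :+ (:- (a :* c :+ s :* c)) :* (c :+ c :- :# 1)
         :+ a :* (c :* c :+ s :* s :- :# 1))
       refl ½ s a) ,
     mod (s * a - ½ * ½) ½ (solve 3 (λ c s a →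
       let x = c :* a :- s :* (:- c) :- a
           y = s :* a :+ c :* (:- c) :- (:- c) in
       s :* x :+ c :* y := c :+ (s :* a :- c :* c) :* (c :+ c :- :# 1)
         :+ c :* (c :* c :+ s :* s :- :# 1))
       refl ½ s a))
  reflect-T : Isometry.to reflect T ≈ₚ T
  reflect-T = reflect-to
    (mod (s * ½ - a * (½ + 1#)) a (solve 3 (λ c s a →
       let x = c :* a :- s :* c :- a :+ a
           y = s :* a :+ c :* c :- c :+ (:- c) in
       s :* y :- c :* x := x :+ (s :* c :- a :* (c :+ :# 1)) :* (c :+ c :- :# 1)
         :+ a :* (c :* c :+ s :* s :- :# 1))
       refl ½ s a) ,
     mod (s * a + ½ * (½ - 1#)) (- ½) (solve 3 (λ c s a →
       let x = c :* a :- s :* c :- a :+ a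
           y = s :* a :+ c :* c :- c :+ (:- c) in
       s :* x :+ c :* y := y :+ (s :* a :+ c :* (c :- :# 1)) :* (c :+ c :- :# 1)
         :+ (:- c) :* (c :* c :+ s :* s :- :# 1))
       refl ½ s a))

  -- With x the side of the hexagon, `κ` belongs to the isosceles triangle with legs x and an angle
  -- of 120°, `ρ` to the distance √3 x and `σ` to 2x.
  p τ κ ρ σ : ℝ
  p = pr o [ u₀ ]
  τ = pr o (u₀ ∷ h₁ ∷ [])
  κ = pr o (u₀ ∷ h₂ ∷ [])
  ρ = pr u₀ [ h₂ ]
  σ = pr u₀ [ h₃ ]

  sq-o-u₀ : sq o u₀ ≈ n
  sq-o-u₀ = trans (solve 2 (λ a c →
    (:# 0 :- a) :* (:# 0 :- a) :+ (:# 0 :- :- c) :* (:# 0 :- :- c) := a :* a :+ c :* c) refl a ½) a²+½²≈n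

  sq-o-u₁ : sq o u₁ ≈ n
  sq-o-u₁ = trans (solve 2 (λ a c →
    (:# 0 :- a) :* (:# 0 :- a) :+ (:# 0 :- c) :* (:# 0 :- c) := a :* a :+ c :* c) refl a ½) a²+½²≈n

  sq-u₀-h₂ : sq u₀ h₂ ≈ fromℕ 3 * n
  sq-u₀-h₂ = trans (mod (- fromℕ 2 * (a * a + ½ * ½)) (a * a + ½ * ½) (solve 3 (λ c s a →
    let x = a :- (c :* a :- s :* (:- c) :- a)
        y = (:- c) :- (s :* a :+ c :* (:- c) :- (:- c))
        N = a :* a :+ c :* c in
    x :* x :+ y :* y := :# 3 :* N :+ (:- :# 2 :* N) :* (c :+ c :- :# 1)
      :+ N :* (c :* c :+ s :* s :- :# 1))
    refl ½ s a)) (*-congˡ a²+½²≈n)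

  sq-u₀-h₃ : sq u₀ h₃ ≈ fromℕ 4 * n
  sq-u₀-h₃ = trans (solve 2 (λ a c →
    (a :- (:# 0 :- a)) :* (a :- (:# 0 :- a)) :+ (:- c :- (:# 0 :- :- c)) :* (:- c :- (:# 0 :- :- c)) :=
    :# 4 :* (a :* a :+ c :* c)) refl a ½) (*-congˡ a²+½²≈n)

  private
    [½+½]²≈1 : (½ + ½) * (½ + ½) ≈ 1#
    [½+½]²≈1 = trans (*-cong ½+½≈1 ½+½≈1) (*-identityˡ 1#)

    oh₁≈p : pr o [ h₁ ] ≈ p
    oh₁≈p = sym (pr-move rot rot-o (rot-u₀ ∷ []))
    oh₂≈p : pr o [ h₂ ] ≈ p
    oh₂≈p = trans (sym (pr-move rot rot-o (rot-h₁ ∷ []))) oh₁≈p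
    oh₃≈p : pr o [ h₃ ] ≈ p
    oh₃≈p = trans (sym (pr-move rot rot-o (rot-h₂ ∷ []))) oh₂≈p
    ot₁≈p : pr o [ t₁ ] ≈ p
    ot₁≈p = trans (sym (pr-move rot rot-o (rot-u₁ ∷ [])))
      (pr-pair-cong (trans sq-o-u₁ (sym sq-o-u₀)) (λ eq → ¼≤x⇒x≉0 ¼≤n (trans (sym sq-o-u₁) eq)))
    u₀h₁≈p : pr u₀ [ h₁ ] ≈ p
    u₀h₁≈p = trans (sym (pr-move rot′ rot′-o (rot′-h₁ ∷ []))) oh₁≈p
    h₁h₂≈p : pr h₁ [ h₂ ] ≈ p
    h₁h₂≈p = trans (sym (pr-move rot rot-u₀ (rot-h₁ ∷ []))) u₀h₁≈p
    h₂h₃≈p : pr h₂ [ h₃ ] ≈ p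
    h₂h₃≈p = trans (sym (pr-move rot rot-h₁ (rot-h₂ ∷ []))) h₁h₂≈p
    h₁h₃≈ρ : pr h₁ [ h₃ ] ≈ ρ
    h₁h₃≈ρ = sym (pr-move rot rot-u₀ (rot-h₂ ∷ []))

    oh₁h₂≈τ : pr o (h₁ ∷ h₂ ∷ []) ≈ τ
    oh₁h₂≈τ = sym (pr-move rot rot-o (rot-u₀ ∷ rot-h₁ ∷ []))
    oh₂h₃≈τ : pr o (h₂ ∷ h₃ ∷ []) ≈ τ
    oh₂h₃≈τ = trans (sym (pr-move rot rot-o (rot-h₁ ∷ rot-h₂ ∷ []))) oh₁h₂≈τ

    oh₁h₃≈κ : pr o (h₁ ∷ h₃ ∷ []) ≈ κ
    oh₁h₃≈κ = sym (pr-move rot rot-o (rot-u₀ ∷ rot-h₂ ∷ []))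
    h₁h₂u₀≈κ : pr h₁ (h₂ ∷ u₀ ∷ []) ≈ κ
    h₁h₂u₀≈κ = sym (pr-move halfTurn halfTurn-o (halfTurn-u₀ ∷ halfTurn-h₂ ∷ []))
    h₂h₃h₁≈κ : pr h₂ (h₃ ∷ h₁ ∷ []) ≈ κ
    h₂h₃h₁≈κ = trans (sym (pr-move rot rot-h₁ (rot-h₂ ∷ rot-u₀ ∷ []))) h₁h₂u₀≈κ

    oh₁h₂h₃≈ : pr o (h₁ ∷ h₂ ∷ h₃ ∷ []) ≈ pr o (u₀ ∷ h₁ ∷ h₂ ∷ [])
    oh₁h₂h₃≈ = sym (pr-move rot rot-o (rot-u₀ ∷ rot-h₁ ∷ rot-h₂ ∷ []))

    u₀u₁≈0 : pr u₀ [ u₁ ] ≈ 0#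
    u₀u₁≈0 = sq≈1⇒pr≈0 u₀ u₁ (trans (solve 2 (λ a c →
      (a :- a) :* (a :- a) :+ (:- c :- c) :* (:- c :- c) := (c :+ c) :* (c :+ c)) refl a ½) [½+½]²≈1)
    h₁t₁≈0 : pr h₁ [ t₁ ] ≈ 0#
    h₁t₁≈0 = trans (sym (pr-move rot rot-u₀ (rot-u₁ ∷ []))) u₀u₁≈0
    h₁T≈0 : pr h₁ [ T ] ≈ 0#
    h₁T≈0 = trans (sym (pr-move rot′ rot′-h₁ (rot′-t₁ ∷ []))) h₁t₁≈0
    t₁T≈0 : pr t₁ [ T ] ≈ 0#
    t₁T≈0 = sq≈1⇒pr≈0 t₁ T (trans (solve 4 (λ a c e f →
      (e :- (e :- a :+ a)) :* (e :- (e :- a :+ a)) :+ (f :- (f :- c :+ :- c)) :* (f :- (f :- c :+ :- c)) :=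
      (c :+ c) :* (c :+ c)) refl a ½ _ _) [½+½]²≈1)

    -- The two extra triangles of `apex` are moved so that both contain `o` and `T`; their third
    -- vertices become `u₀` and `u₁`, the ends of a unit edge.
    u₀oT≈ : pr u₀ (o ∷ T ∷ []) ≈ pr o (h₂ ∷ t₁ ∷ [])
    u₀oT≈ = sym (pr-move rot′ rot′-o (rot′-h₂ ∷ rot′-t₁ ∷ []))
    ou₁T≈ : pr o (u₁ ∷ T ∷ []) ≈ pr o (h₂ ∷ T ∷ [])
    ou₁T≈ = sym (pr-move reflect reflect-o (reflect-h₂ ∷ reflect-T ∷ []))

  13τ+1≤11p+2ρ+σ : fromℕ 13 * τ + 1# ≤ fromℕ 11 * p + fromℕ 2 * ρ + σ
  13τ+1≤11p+2ρ+σ = y-x≈z⇒x≤y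
    (solve 6 (λ τ κ λ′ p ρ σ →
      -- By symmetry the weights of the trapezoid inequality collect to 5 + 5 + 3 = 13 for `τ`, 11
      -- for `p`, 2 for `ρ` and 1 for `σ`. The terms in `κ` (3 + 2 + 2 against 7) and in `λ′` (6
      -- against 6) cancel.
      (:# 11 :* p :+ :# 2 :* ρ :+ σ) :- (:# 13 :* τ :+ :# 1) :=
      (:# 1 :* p :+ (:# 4 :* p :+ (:# 2 :* p :+ (:# 1 :* p :+ (:# 1 :* p :+ (:# 1 :* p :+ (:# 1 :* p :+
        (:# 1 :* ρ :+ (:# 1 :* ρ :+ (:# 1 :* σ :+ (:# 7 :* κ :+ (:# 6 :* λ′ :+ :# 0)))))))))))) :-
      (:# 1 :* :# 1 :+ (:# 5 :* τ :+ (:# 5 :* τ :+ (:# 3 :* τ :+ (:# 3 :* κ :+ (:# 2 :* κ :+ (:# 2 :* κ :+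
        (:# 6 :* λ′ :+ :# 0)))))))))
      refl τ κ (pr o (u₀ ∷ h₁ ∷ h₂ ∷ [])) p ρ σ)
    (x≤y⇒0≤y-x (weighted-mono (o ∷ u₀ ∷ h₁ ∷ h₂ ∷ h₃ ∷ []) trapezoidˡ trapezoidʳ
      (1# ∷ τ ∷ τ ∷ τ ∷ κ ∷ κ ∷ κ ∷ pr o (u₀ ∷ h₁ ∷ h₂ ∷ []) ∷ [])
      (p ∷ p ∷ p ∷ p ∷ p ∷ p ∷ p ∷ ρ ∷ ρ ∷ σ ∷ κ ∷ pr o (u₀ ∷ h₁ ∷ h₂ ∷ []) ∷ [])
      trapezoid
      (pr[]≈1 o ∷ refl ∷ oh₁h₂≈τ ∷ oh₂h₃≈τ ∷ refl ∷ h₁h₂u₀≈κ ∷ h₂h₃h₁≈κ ∷ oh₁h₂h₃≈ ∷ [])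
      (refl ∷ oh₁≈p ∷ oh₂≈p ∷ oh₃≈p ∷ u₀h₁≈p ∷ h₁h₂≈p ∷ h₂h₃≈p ∷ refl ∷ h₁h₃≈ρ ∷ refl ∷
       oh₁h₃≈κ ∷ refl ∷ [])))

  3p≤1+τ : fromℕ 3 * p ≤ 1# + τ
  3p≤1+τ = y-x≈z⇒x≤y
    (solve 5 (λ p τ θ φ ψ →
      -- Adding the averages of `apex` and `unitEdge` cancels `θ`, `φ` and `ψ`.
      (:# 1 :+ τ) :- :# 3 :* p :=
      ((:# 1 :* :# 1 :+ (:# 1 :* τ :+ (:# 1 :* φ :+ (:# 1 :* ψ :+ 
        (:# 1 :* :# 0 :+ (:# 1 :* :# 0 :+ (:# 1 :* :# 0 :+ :# 0))))))) :-
       (:# 1 :* p :+ (:# 1 :* p :+ (:# 1 :* p :+ (:# 1 :* θ :+ :# 0))))) :+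
      ((:# 1 :* θ :+ (:# 1 :* :# 0 :+ :# 0)) :- (:# 1 :* φ :+ (:# 1 :* ψ :+ :# 0))))
      refl p τ (pr o [ T ]) (pr o (h₂ ∷ t₁ ∷ [])) (pr o (h₂ ∷ T ∷ [])))
    (0≤+
      (x≤y⇒0≤y-x (weighted-mono (o ∷ h₁ ∷ h₂ ∷ t₁ ∷ T ∷ []) apexˡ apexʳ
        (p ∷ p ∷ p ∷ pr o [ T ] ∷ [])
        (1# ∷ τ ∷ pr o (h₂ ∷ t₁ ∷ []) ∷ pr o (h₂ ∷ T ∷ []) ∷ 0# ∷ 0# ∷ 0# ∷ [])
        apex
        (oh₁≈p ∷ oh₂≈p ∷ ot₁≈p ∷ refl ∷ [])
        (pr[]≈1 o ∷ oh₁h₂≈τ ∷ refl ∷ refl ∷ h₁t₁≈0 ∷ h₁T≈0 ∷ t₁T≈0 ∷ [])))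
      (x≤y⇒0≤y-x (weighted-mono (o ∷ u₀ ∷ T ∷ u₁ ∷ []) unitEdgeˡ unitEdgeʳ
        (pr o (h₂ ∷ t₁ ∷ []) ∷ pr o (h₂ ∷ T ∷ []) ∷ [])
        (pr o [ T ] ∷ 0# ∷ [])
        unitEdge
        (u₀oT≈ ∷ ou₁T≈ ∷ [])
        (refl ∷ u₀u₁≈0 ∷ []))))

  -- Adding 13 times the second inequality to the first eliminates `τ`.
  28p≤12+2ρ+σ : fromℕ 28 * p ≤ fromℕ 12 + fromℕ 2 * ρ + σ
  28p≤12+2ρ+σ = y-x≈z⇒x≤y
    (solve 4 (λ p τ ρ σ →
      (:# 12 :+ :# 2 :* ρ :+ σ) :- :# 28 :* p :=
      ((:# 11 :* p :+ :# 2 :* ρ :+ σ) :- (:# 13 :* τ :+ :# 1)) :+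
      :# 13 :* ((:# 1 :+ τ) :- :# 3 :* p)) refl p τ ρ σ)
    (0≤+ (x≤y⇒0≤y-x 13τ+1≤11p+2ρ+σ) (0≤k*x 13 (x≤y⇒0≤y-x 3p≤1+τ)))

-- The upper bound 12/25 for distances at least 1/2.

module UpperBound (F : CompleteOrderedField) (c₀ : Plane.ProperColouring F)
  (m : Plane.LeftInvariantProbability F) where
  open Reals F hiding (total)
  open Coordinates F
  open Monochromaticity F c₀ m

  Value : Pred ℝ 0ℓ
  Value r = ∃ λ A → ∃ λ B → ¼≤ sq A B × r ≈ pr A [ B ]

  pr≤1 : ∀ A B → pr A [ B ] ≤ 1#
  pr≤1 A B = y-x≈z⇒x≤y
    (solve 1 (λ p → :# 1 :- p := (:# 1 :* :# 1 :+ :# 0) :- (:# 1 :* p :+ :# 0)) refl (pr A [ B ]))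
    (x≤y⇒0≤y-x (weighted-mono (A ∷ B ∷ [])
      pairˡ pairʳ (pr A [ B ] ∷ []) (1# ∷ []) pair
      (refl ∷ []) (pr[]≈1 A ∷ [])))

  ¼≤1 : ¼≤ 1#
  ¼≤1 = ≤-resp refl (*-identityˡ 1#) (²-mono-≤ 0≤½
    (≤-resp (+-identityʳ ½) ½+½≈1 (+-monoʳ-≤ ½ 0≤½)))

  private
    sq-o-1 : 1# ≈ sq o (1# , 0#)
    sq-o-1 = solve 0 (:# 1 :=
      (:# 0 :- :# 1) :* (:# 0 :- :# 1) :+ (:# 0 :- :# 0) :* (:# 0 :- :# 0)) refl

    sup : ∃ λ S → UpperBound Value S × (∀ b → UpperBound Value b → S ≤ b)
    sup = supremum Value
      (_ , o , (1# , 0#) , ≤-resp refl sq-o-1 ¼≤1 , refl)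
      (1# , λ (A , B , _ , r≈) → ≤-resp (sym r≈) refl (pr≤1 A B))

    S : ℝ
    S = proj₁ sup

    pr≤S : ∀ A B → ¼≤ sq A B → pr A [ B ] ≤ S
    pr≤S A B p = proj₁ (proj₂ sup) (A , B , p , refl)

    -- The squared distances `3n` and `4n` behind `ρ` and `σ` are again at least 1/4, so both
    -- probabilities are at most `S`.
    28pr≤12+3S : ∀ A B → ¼≤ sq A B → fromℕ 28 * pr A [ B ] ≤ fromℕ 12 + fromℕ 3 * S
    28pr≤12+3S A B ¼≤n = y-x≈z⇒x≤y
      (trans (+-congˡ (-‿cong (*-congˡ pr≈p)))
        (solve 4 (λ p ρ σ S →
          (:# 12 :+ :# 3 :* S) :- :# 28 :* p :=
          (:# 12 :+ :# 2 :* ρ :+ σ :- :# 28 :* p) :+ :# 2 :* (S :- ρ) :+ (S :- σ)) refl p ρ σ S))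
      (0≤+ (0≤+ (x≤y⇒0≤y-x 28p≤12+2ρ+σ)
        (0≤k*x 2 (x≤y⇒0≤y-x (pr≤S _ _ (≤-resp refl (sym sq-u₀-h₂) (¼≤k*n 2))))))
        (x≤y⇒0≤y-x (pr≤S _ _ (≤-resp refl (sym sq-u₀-h₃) (¼≤k*n 3)))))
      where
      n : ℝ
      n = sq A B
      open Hexagon F c₀ m n ¼≤n using (p; ρ; σ; u₀; sq-o-u₀; sq-u₀-h₂; sq-u₀-h₃; 28p≤12+2ρ+σ)
      pr≈p : pr A [ B ] ≈ p
      pr≈p = pr-pair-cong (sym sq-o-u₀) (¼≤x⇒x≉0 ¼≤n)
      ¼≤k*n : ∀ k → ¼≤ (fromℕ (suc k) * n)
      ¼≤k*n k = ≤-trans ¼≤n (≤-resp (*-identityʳ n) (*-comm n _) (*-monoˡ-≤ n (0≤sq A B)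
        (≤-resp (+-identityʳ 1#) refl (+-monoʳ-≤ 1# (0≤fromℕ k)))))

    25S≤12 : fromℕ 25 * S ≤ fromℕ 12
    25S≤12 = ≤-resp
      (solve 1 (λ S → :# 28 :* S :- :# 3 :* S := :# 25 :* S) refl S)
      (solve 1 (λ S → (:# 12 :+ :# 3 :* S) :- :# 3 :* S := :# 12) refl S)
      (+-monoˡ-≤ (- (fromℕ 3 * S)) 28S≤12+3S)
      where
      28S≤12+3S : fromℕ 28 * S ≤ fromℕ 12 + fromℕ 3 * S
      28S≤12+3S = ≤-resp refl (*-/ (fromℕ 28) _ (fromℕ-suc≉0 27))
        -- `(12 + 3S)/28` bounds every value, hence also the least upper bound `S`.
        (*-monoˡ-≤ (fromℕ 28) (0≤fromℕ 28) (proj₂ (proj₂ sup) ((fromℕ 12 + fromℕ 3 * S) / fromℕ 28)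
          λ (A , B , p , r≈) → *-cancelˡ-≤ (fromℕ 28) (0≤fromℕ 28) (fromℕ-suc≉0 27)
            (≤-resp (*-congˡ (sym r≈)) (sym (*-/ (fromℕ 28) _ (fromℕ-suc≉0 27))) (28pr≤12+3S A B p))))

  25pr≤12 : ∀ A B → ¼≤ sq A B → fromℕ 25 * pr A [ B ] ≤ fromℕ 12
  25pr≤12 A B p = ≤-trans (*-monoˡ-≤ (fromℕ 25) (0≤fromℕ 25) (pr≤S A B p)) 25S≤12

-- The five-point configuration and the lower bound 1/125.

module LowerBound (F : CompleteOrderedField) (c₀ : Plane.ProperColouring F)
  (m : Plane.LeftInvariantProbability F) (n : CompleteOrderedField.ℝ F)
  (admissible : Thresholds.Admissible F n) where
  open Reals F hiding (total)
  open Coordinates F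
  open Monochromaticity F c₀ m
  open UpperBound F c₀ m using (25pr≤12)
  open Thresholds F using (5-2√3; 5+2√3)

  h : ℝ
  h = √ (n - ½ * ½)

  h²≈n-½² : h * h ≈ n - ½ * ½
  h²≈n-½² = √-square (x≤y⇒0≤y-x (proj₁ admissible))

  ½²+h²≈n : ½ * ½ + h * h ≈ n
  ½²+h²≈n = trans (+-comm _ _) (trans (+-congʳ h²≈n-½²) (x-y+y n (½ * ½)))

  0≤h : 0# ≤ h
  0≤h = √-nonNeg (n - ½ * ½)

  -- The equilateral triangle OBC has unit sides; P lies at height h over the
  -- side BC on the inner side, Q at height h over OB on the outer side.
  O B C P Q : Point
  O = 0# , s
  B = - ½ , 0#
  C = ½ , 0#
  P = 0# , h
  Q = - (½ * ½ + s * h) , ½ * (s + h)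

  private
    [½+½]²≈1 : (½ + ½) * (½ + ½) ≈ 1#
    [½+½]²≈1 = trans (*-cong ½+½≈1 ½+½≈1) (*-identityˡ 1#)

  sq-O-B : sq O B ≈ 1#
  sq-O-B = trans (solve 2 (λ c s →
    (:# 0 :- :- c) :* (:# 0 :- :- c) :+ (s :- :# 0) :* (s :- :# 0) := c :* c :+ s :* s) refl ½ s) ½²+s²≈1
  sq-O-C : sq O C ≈ 1#
  sq-O-C = trans (solve 2 (λ c s →
    (:# 0 :- c) :* (:# 0 :- c) :+ (s :- :# 0) :* (s :- :# 0) := c :* c :+ s :* s) refl ½ s) ½²+s²≈1
  sq-B-C : sq B C ≈ 1#
  sq-B-C = trans (solve 1 (λ c →
    (:- c :- c) :* (:- c :- c) :+ (:# 0 :- :# 0) :* (:# 0 :- :# 0) := (c :+ c) :* (c :+ c)) refl ½) [½+½]²≈1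

  sq-P-B : sq P B ≈ n
  sq-P-B = trans (solve 2 (λ c h →
    (:# 0 :- :- c) :* (:# 0 :- :- c) :+ (h :- :# 0) :* (h :- :# 0) := c :* c :+ h :* h) refl ½ h) ½²+h²≈n
  sq-P-C : sq P C ≈ n
  sq-P-C = trans (solve 2 (λ c h →
    (:# 0 :- c) :* (:# 0 :- c) :+ (h :- :# 0) :* (h :- :# 0) := c :* c :+ h :* h) refl ½ h) ½²+h²≈n

  -- Geometrically, the rotation by 60° about `B` takes `C` to `O` and `P` to `Q`. So QO and QB are
  -- as long as PC and PB, and the triangle BPQ is equilateral.
  sq-Q-O : sq Q O ≈ n
  sq-Q-O = trans (mod (s * ((½ * (s + h) - s) + ½ * (h - s))) (½ * ½ + h * h) (solve 3 (λ c s h →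
    let x = :- (c :* c :+ s :* h) :- :# 0
        y = c :* (s :+ h) :- s
        N = c :* c :+ h :* h in
    x :* x :+ y :* y := N :+ (s :* (y :+ c :* (h :- s))) :* (c :+ c :- :# 1)
      :+ N :* (c :* c :+ s :* s :- :# 1))
    refl ½ s h)) ½²+h²≈n

  sq-Q-B : sq Q B ≈ n
  sq-Q-B = trans (mod (- ½ * ((- (½ * ½ + s * h) - - ½) + (½ * ½ - s * h))) (½ * ½ + h * h) (solve 3 (λ c s h →
    let x = :- (c :* c :+ s :* h) :- :- c
        y = c :* (s :+ h) :- :# 0
        N = c :* c :+ h :* h in
    x :* x :+ y :* y := N :+ (:- c :* (x :+ (c :* c :- s :* h))) :* (c :+ c :- :# 1)
      :+ N :* (c :* c :+ s :* s :- :# 1))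
    refl ½ s h)) ½²+h²≈n

  sq-P-Q : sq P Q ≈ n
  sq-P-Q = trans (mod (- h * ((h - ½ * (s + h)) + ½ * (h - s))) (½ * ½ + h * h) (solve 3 (λ c s h →
    let x = :# 0 :- :- (c :* c :+ s :* h)
        y = h :- c :* (s :+ h)
        N = c :* c :+ h :* h in
    x :* x :+ y :* y := N :+ (:- h :* (y :+ c :* (h :- s))) :* (c :+ c :- :# 1)
      :+ N :* (c :* c :+ s :* s :- :# 1))
    refl ½ s h)) ½²+h²≈n

  -- `O` and `P` lie over the midpoint of BC, on the same side at heights `s` and `h`. `C` and `Q`
  -- lie likewise over the midpoint of OB, but on opposite sides, which gives `s + h` in the next
  -- lemma.
  sq-P-O : sq P O ≈ (s - h) * (s - h)
  sq-P-O = solve 2 (λ s h →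
    (:# 0 :- :# 0) :* (:# 0 :- :# 0) :+ (h :- s) :* (h :- s) := (s :- h) :* (s :- h)) refl s h

  sq-Q-C : sq Q C ≈ (s + h) * (s + h)
  sq-Q-C = mod (- (½ + 1#) * ((- (½ * ½ + s * h) - ½) + - (s * s + s * h)))
    ((s + h) * (s + h) + ((- (½ * ½ + s * h) - ½) + - (s * s + s * h)))
    (solve 3 (λ c s h →
    let x = :- (c :* c :+ s :* h) :- c
        y = c :* (s :+ h) :- :# 0
        z = x :+ :- (s :* s :+ s :* h) in
    x :* x :+ y :* y := (s :+ h) :* (s :+ h) :+ (:- (c :+ :# 1) :* z) :* (c :+ c :- :# 1)
      :+ ((s :+ h) :* (s :+ h) :+ z) :* (c :* c :+ s :* s :- :# 1))
    refl ½ s h)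

  private
    0≤s : 0# ≤ s
    0≤s = *-nonNeg 0≤½ (√-nonNeg (fromℕ 3))

    s²-½²≈½ : s * s - ½ * ½ ≈ ½
    s²-½²≈½ = mod (- (½ + 1#)) 1# (solve 2 (λ c s →
      s :* s :- c :* c := c :+ (:- (c :+ :# 1)) :* (c :+ c :- :# 1)
        :+ :# 1 :* (c :* c :+ s :* s :- :# 1)) refl ½ s)

    ½≤s : ½ ≤ s
    ½≤s = ²-cancel-≤ 0≤s (y-x≈z⇒x≤y s²-½²≈½ 0≤½)

  -- Since (s ∓ ½)² + ¼ = (5 ∓ 2√3)/4, the two cases of admissibility amount to `h ≤ s - ½` and
  -- `s + ½ ≤ h`.
  ¼≤[s-h]² : ¼≤ (s - h) * (s - h)
  ¼≤[s-h]² with proj₂ admissible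
  ... | inj₁ n≤ = ²-mono-≤ 0≤½ (y-x≈z⇒x≤y
      (solve 3 (λ c s h → (s :- h) :- c := (s :- c) :- h) refl ½ s h)
      (x≤y⇒0≤y-x (²-cancel-≤ (x≤y⇒0≤y-x ½≤s) (≤-resp (sym h²≈n-½²)
        (sym (mod (- (½ + ½ + 1#)) 1# (solve 2 (λ c r →
          (c :* r :- c) :* (c :* r :- c) :=
          (c :* c :* (:# 5 :- :# 2 :* r) :- c :* c) :+ (:- (c :+ c :+ :# 1)) :* (c :+ c :- :# 1)
            :+ :# 1 :* (c :* c :+ (c :* r) :* (c :* r) :- :# 1)) refl ½ √3)))
        (+-monoˡ-≤ (- (½ * ½)) n≤)))))
  ... | inj₂ ≤n = ≤-resp refl
      (solve 2 (λ s h → (h :- s) :* (h :- s) := (s :- h) :* (s :- h)) refl s h)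
      (²-mono-≤ 0≤½ (y-x≈z⇒x≤y
        (solve 3 (λ c s h → (h :- s) :- c := h :- (s :+ c)) refl ½ s h)
        (x≤y⇒0≤y-x (²-cancel-≤ 0≤h (≤-resp
          (sym (mod (- (½ + ½ + 1#)) 1# (solve 2 (λ c r →
            (c :* r :+ c) :* (c :* r :+ c) :=
            (c :* c :* (:# 5 :+ :# 2 :* r) :- c :* c) :+ (:- (c :+ c :+ :# 1)) :* (c :+ c :- :# 1)
              :+ :# 1 :* (c :* c :+ (c :* r) :* (c :* r) :- :# 1)) refl ½ √3)))
          (sym h²≈n-½²)
          (+-monoˡ-≤ (- (½ * ½)) ≤n))))))

  ¼≤[s+h]² : ¼≤ (s + h) * (s + h)
  ¼≤[s+h]² = ²-mono-≤ 0≤½ (≤-trans ½≤s (≤-resp (+-identityʳ s) refl (+-monoʳ-≤ s 0≤h)))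

  1≤125pr : ∀ X Y → sq X Y ≈ n → 1# ≤ fromℕ 125 * pr X [ Y ]
  1≤125pr X Y sq≈n = y-x≈z⇒x≤y
    (solve 3 (λ p x y →
      -- 25 times the pigeonhole bound; `25 x` and `25 y` are at most 12 each, which leaves 25 - 24
      -- = 1.
      :# 125 :* p :- :# 1 :=
      :# 25 :* ((:# 1 :* :# 0 :+ (:# 1 :* :# 0 :+ (:# 1 :* :# 0 :+ (:# 1 :* p :+ (:# 1 :* p :+ (:# 1 :* p :+
        (:# 1 :* p :+ (:# 1 :* p :+ (:# 1 :* x :+ (:# 1 :* y :+ :# 0)))))))))) :- (:# 1 :* :# 1 :+ :# 0)) :+
      (:# 12 :- :# 25 :* x) :+ (:# 12 :- :# 25 :* y)) refl (pr X [ Y ]) (pr P [ O ]) (pr Q [ C ]))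
    (0≤+ (0≤+
      (0≤k*x 25 (x≤y⇒0≤y-x (weighted-mono (O ∷ B ∷ C ∷ P ∷ Q ∷ []) pigeonholeˡ pigeonholeʳ
        (1# ∷ [])
        (0# ∷ 0# ∷ 0# ∷ p ∷ p ∷ p ∷ p ∷ p ∷ pr P [ O ] ∷ pr Q [ C ] ∷ [])
        pigeonhole
        (pr[]≈1 O ∷ [])
        (sq≈1⇒pr≈0 O B sq-O-B ∷ sq≈1⇒pr≈0 O C sq-O-C ∷ sq≈1⇒pr≈0 B C sq-B-C ∷
         pr≈p sq-P-B ∷ pr≈p sq-P-C ∷ pr≈p sq-Q-O ∷ pr≈p sq-Q-B ∷ pr≈p sq-P-Q ∷ refl ∷ refl ∷ []))))
      (x≤y⇒0≤y-x (25pr≤12 P O (≤-resp refl (sym sq-P-O) ¼≤[s-h]²))))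
      (x≤y⇒0≤y-x (25pr≤12 Q C (≤-resp refl (sym sq-Q-C) ¼≤[s+h]²))))
    where
    p : ℝ
    p = pr X [ Y ]
    pr≈p : ∀ {X′ Y′} → sq X′ Y′ ≈ n → pr X′ [ Y′ ] ≈ p
    pr≈p eq = pr-pair-cong (trans eq (sym sq≈n)) λ sq≈0 → ¼≤x⇒x≉0 (proj₁ admissible) (trans (sym eq) sq≈0)

-- From 1/125 to the six stated bounds.

module Conclusion (F : CompleteOrderedField) (c₀ : Plane.ProperColouring F)
  (m : Plane.LeftInvariantProbability F) where
  open Reals F hiding (total)
  open Thresholds F using (Admissible)
  open Monochromaticity F c₀ m

  0≤dist : ∀ {A B d} → dist A B ≈ d → 0# ≤ d
  0≤dist dist≈d = ≤-resp refl dist≈d (√-nonNeg _)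

  -- Every stated constant is a fraction k/(1+j) ≤ 1 of 1/125: 250 = 2 · 125, and 28/3875 is 28/31
  -- of 1/125.
  k/[1+j]*125≤probMono : ∀ {A B d k} j → dist A B ≈ d → Admissible (d * d) → k ℕ.≤ suc j →
                       fromℕ k / fromℕ (suc j ℕ.* 125) ≤ probMono c₀ m A B
  -- `suc j * 125` reduces to the successor of `124 + j * 125`.
  k/[1+j]*125≤probMono {A} {B} {d} j dist≈d adm k≤j = x≤k*y⇒x/k≤y (124 ℕ.+ j ℕ.* 125)
    (≤-trans (fromℕ-mono-≤ k≤j) (≤-resp (*-identityʳ _)
      (trans (sym (*-assoc (fromℕ (suc j)) (fromℕ 125) _))
        (*-cong (sym (×1-homo-* (suc j) 125)) (pr≈probMono A B)))
      (*-monoˡ-≤ (fromℕ (suc j)) (0≤fromℕ (suc j))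
        (LowerBound.1≤125pr F c₀ m (d * d) adm A B
          (trans (sym (dist²≈sq A B)) (*-cong dist≈d dist≈d))))))

mainTheorem7 : (F : CompleteOrderedField) →
    let open CompleteOrderedField F
        open Plane F
    in (c₀ : ProperColouring) (m : LeftInvariantProbability) →
       (d : ℝ) (A B : Point) → dist A B ≈ d →
       let p = probMono c₀ m A B
           √2 = √ (fromℕ 2)
           √3 = √ (fromℕ 3)
           √5 = √ (fromℕ 5)
           ½ = 1# / fromℕ 2
       in (½ ≤ d → d ≤ √ ((fromℕ 3 - √3) * (1# - 1# / √2)) →
             fromℕ 1 / fromℕ 125 ≤ p)
        × (√ ((fromℕ 3 - √3) * (1# - 1# / √2)) < d → d ≤ √ (fromℕ 19 / fromℕ 15 - fromℕ 2 / √5) →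
             fromℕ 28 / fromℕ 3875 ≤ p)
        × (√ (fromℕ 19 / fromℕ 15 - fromℕ 2 / √5) < d → d ≤ ½ * √ (fromℕ 5 - fromℕ 2 * √3) →
             fromℕ 1 / fromℕ 250 ≤ p)
        × (½ * √ (fromℕ 5 + fromℕ 2 * √3) ≤ d → d < √ (fromℕ 19 / fromℕ 15 + fromℕ 2 / √5) →
             fromℕ 1 / fromℕ 250 ≤ p)
        × (√ (fromℕ 19 / fromℕ 15 + fromℕ 2 / √5) ≤ d → d < √ ((fromℕ 3 - √3) * (1# + 1# / √2)) →
             fromℕ 28 / fromℕ 3875 ≤ p)
        × (√ ((fromℕ 3 - √3) * (1# + 1# / √2)) ≤ d →
             fromℕ 1 / fromℕ 125 ≤ p)
mainTheorem7 F c₀ m d A B dist≈d =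
  (λ ½≤d d≤ → bound 0 dist≈d (admissible₁ 0≤d ½≤d d≤) (from-yes (1 ℕ.≤? 1))) ,
  (λ <d d≤ → bound 30 dist≈d (admissible₂ 0≤d (proj₁ <d) d≤) (from-yes (28 ℕ.≤? 31))) ,
  (λ <d d≤ → bound 1 dist≈d (admissible₃ 0≤d (proj₁ <d) d≤) (from-yes (1 ℕ.≤? 2))) ,
  (λ ≤d _ → bound 1 dist≈d (admissible₄ 0≤d ≤d) (from-yes (1 ℕ.≤? 2))) ,
  (λ ≤d _ → bound 30 dist≈d (admissible₅ 0≤d ≤d) (from-yes (28 ℕ.≤? 31))) ,
  (λ ≤d → bound 0 dist≈d (admissible₆ 0≤d ≤d) (from-yes (1 ℕ.≤? 1)))
  where
  open Thresholds F
  open Conclusion F c₀ m renaming (k/[1+j]*125≤probMono to bound)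
  0≤d = 0≤dist dist≈d
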